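{- Let $n\ge 8$ be an integer and $G$ an arbitrary (not necessarily connected) graph of order $n$. Let $|M_G|$ be the number of maximal induced matchings of $G$. Then, writing $t$ for a positive integer, \[ |M_G|\le q(n)=\begin{cases} 10^{t} & \text{if } n=5t;\\ 15\cdot 10^{t-1} & \text{if } n=5t+1;\\ 225\cdot 10^{t-2} & \text{if } n=5t+2;\\ 36\cdot 10^{t-1} & \text{if } n=5t+3;\\ 6\cdot 10^{t} & \text{if } n=5t+4, \end{cases} \] with equality if and only if \[ G=\begin{cases} tK_5 & \text{if } n=5t;\\ K_6\cup (t-1)K_5 & \text{if } n=5t+1;\\ 2K_6\cup (t-2)K_5 & \text{if } n=5t+2;\\ 2K_4\cup (t-1)K_5 & \text{if } n=5t+3;\\ K_4\cup tK_5 & \text{if } n=5t+4. \end{cases} \]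
   Context: Graphs are finite, simple and undirected. A matching $M$ of $G$ is an induced matching if the endpoints of its edges induce a $1$-regular subgraph; it is maximal if it is not a proper subset of another induced matching. $G\cup H$ is the disjoint union and $sH$ the disjoint union of $s$ copies of $H$; $K_m$ is the complete graph on $m$ vertices. -}

module Defs where

open import Data.Bool using (Bool; true; false; T; _∧_; not)
open import Data.Nat using (ℕ; zero; suc; _+_; _*_; _∸_; _^_; _%_; _/_)
open import Data.Nat.Properties using () renaming (_≟_ to _≟ℕ_)
open import Data.Fin using (Fin; splitAt)
open import Data.Fin.Properties using (_≟_)
open import Data.Sum using (inj₁; inj₂)
open import Data.Product using (Σ; _×_; _,_)
open import Data.List using (List; []; _∷_; length; replicate)
open import Data.Nat.ListAction using (sum)
open import Data.List.Membership.Propositional using (_∈_)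
open import Data.List.Relation.Unary.Unique.Propositional using (Unique)
open import Data.Vec using (Vec; lookup)
open import Function.Bundles using (_⇔_; _↔_; Inverse)
open import Relation.Nullary using (yes; no; ¬_)
open import Relation.Nullary.Decidable using (⌊_⌋)
open import Relation.Binary.PropositionalEquality using (_≡_; refl; sym)
import Data.Empty

record Graph (n : ℕ) : Set where
  field
    adj    : Fin n → Fin n → Bool
    adj-sym    : ∀ i j → adj i j ≡ adj j i
    adj-irrefl : ∀ i → adj i i ≡ false

open Graph public

Edge : ∀ {n} → Graph n → Fin n → Fin n → Set
Edge G i j = T (adj G i j)

-- Graph isomorphism (between graphs of possibly different stated order;
-- a bijection Fin n ↔ Fin m forces n = m).
_≅_ : ∀ {n m} → Graph n → Graph m → Set
_≅_ {n} {m} G H =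
  Σ (Fin n ↔ Fin m) λ f →
    ∀ i j → adj G i j ≡ adj H (Inverse.to f i) (Inverse.to f j)

-- Edge sets: a symmetric 0/1 adjacency matrix (stored as a Vec of Vecs so
-- that propositional equality is extensional equality of edge sets).

EdgeSet : ℕ → Set
EdgeSet n = Vec (Vec Bool n) n

_∈E_ : ∀ {n} → Fin n × Fin n → EdgeSet n → Set
(i , j) ∈E M = T (lookup (lookup M i) j)

InV : ∀ {n} → EdgeSet n → Fin n → Set
InV M v = Σ _ λ u → (v , u) ∈E M

_⊆E_ : ∀ {n} → EdgeSet n → EdgeSet n → Set
M ⊆E M' = ∀ i j → (i , j) ∈E M → (i , j) ∈E M'

IsInducedMatching : ∀ {n} → Graph n → EdgeSet n → Set
IsInducedMatching {n} G M =
  (∀ i j → (i , j) ∈E M → Edge G i j) ×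
  (∀ i j → lookup (lookup M i) j ≡ lookup (lookup M j) i) ×
  (∀ v → InV M v →
     Σ (Fin n) (λ u → InV M u × Edge G v u) ×
     (∀ u w → InV M u → Edge G v u → InV M w → Edge G v w → u ≡ w))

IsMaximalInducedMatching : ∀ {n} → Graph n → EdgeSet n → Set
IsMaximalInducedMatching G M =
  IsInducedMatching G M ×
  (∀ M' → IsInducedMatching G M' → M ⊆E M' → M ≡ M')

NumMaxIndMatchings : ∀ {n} → Graph n → ℕ → Set
NumMaxIndMatchings {n} G k =
  Σ (List (EdgeSet n)) λ xs →
    Unique xs × (∀ M → (M ∈ xs) ⇔ IsMaximalInducedMatching G M) × (length xs ≡ k)

block : (ls : List ℕ) → Fin (sum ls) → ℕ
block []       ()
block (x ∷ xs) i with splitAt x i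
... | inj₁ _ = zero
... | inj₂ j = suc (block xs j)

cliqueAdj : (ls : List ℕ) → Fin (sum ls) → Fin (sum ls) → Bool
cliqueAdj ls i j = ⌊ block ls i ≟ℕ block ls j ⌋ ∧ not ⌊ i ≟ j ⌋

private
  decSym : ∀ {A : Set} (_≟'_ : (x y : A) → Relation.Nullary.Dec (x ≡ y)) x y →
           ⌊ x ≟' y ⌋ ≡ ⌊ y ≟' x ⌋
  decSym _≟'_ x y with x ≟' y | y ≟' x
  ... | yes _ | yes _ = refl
  ... | no _  | no _  = refl
  ... | yes p | no q  = Data.Empty.⊥-elim (q (sym p))
    where import Data.Empty
  ... | no q  | yes p = Data.Empty.⊥-elim (q (sym p))
    where import Data.Empty

  decRefl : ∀ {A : Set} (_≟'_ : (x y : A) → Relation.Nullary.Dec (x ≡ y)) x →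
            ⌊ x ≟' x ⌋ ≡ true
  decRefl _≟'_ x with x ≟' x
  ... | yes _ = refl
  ... | no q  = Data.Empty.⊥-elim (q refl)
    where import Data.Empty

  ∧-false : ∀ b → (b ∧ false) ≡ false
  ∧-false true  = refl
  ∧-false false = refl

cliqueUnion : (ls : List ℕ) → Graph (sum ls)
cliqueUnion ls = record
  { adj    = cliqueAdj ls
  ; adj-sym    = λ i j → Relation.Binary.PropositionalEquality.cong₂ (λ a b → a ∧ not b)
                       (decSym _≟ℕ_ (block ls i) (block ls j)) (decSym _≟_ i j)
  ; adj-irrefl = λ i → Relation.Binary.PropositionalEquality.trans
                     (Relation.Binary.PropositionalEquality.cong (λ b → ⌊ block ls i ≟ℕ block ls i ⌋ ∧ not b)
                       (decRefl _≟_ i))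
                     (∧-false _)
  }

q : ℕ → ℕ
q n = go (n % 5)
  where
  t = n / 5
  go : ℕ → ℕ
  go 0 = 10 ^ t
  go 1 = 15 * 10 ^ (t ∸ 1)
  go 2 = 225 * 10 ^ (t ∸ 2)
  go 3 = 36 * 10 ^ (t ∸ 1)
  go _ = 6 * 10 ^ t

extremalSizes : ℕ → List ℕ
extremalSizes n = go (n % 5)
  where
  t = n / 5
  go : ℕ → List ℕ
  go 0 = replicate t 5
  go 1 = 6 ∷ replicate (t ∸ 1) 5
  go 2 = 6 ∷ 6 ∷ replicate (t ∸ 2) 5
  go 3 = 4 ∷ 4 ∷ replicate (t ∸ 1) 5
  go _ = 4 ∷ replicate t 5

extremal : (n : ℕ) → Graph (sum (extremalSizes n))
extremal n = cliqueUnion (extremalSizes n)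

{-# OPTIONS --safe #-}

-- An induced matching is determined by its set of endpoints, so maximal induced matchings can be counted as vertex
-- sets U inside an arbitrary vertex set W; write f(W) for their number. Two facts drive an induction on |W|:
--   f(W) ≤ f(W − v) + Σ_{u ∈ N(v)} f(W − N[u] − N[v])   (is v uncovered, or matched to u?), and
--   f(W) = f(S) · f(W − S)   if no edge joins S to W − S.
-- Let v have maximum degree d. For d ≥ 6, or if enough neighbours of v have a neighbour outside N[v], the first
-- inequality alone gives f(W) < bound |W|. If only one or two neighbours of v do, they separate the rest of N[v] from
-- W − N[v]: deleting them and using both facts again gives a strict inequality. If none does, then N[v] is a
-- component, and for 3 ≤ d ≤ 5 it contributes at most the factor d(d+1)/2, with equality only for a clique; the
-- smaller d are never tight from order 4 on. Hence a tight graph is a union of cliques of order 4, 5 and 6.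
module Submission where

open import Defs
open import Data.Bool using (Bool; true; false; T)
open import Data.Bool.Properties using (T?)
open import Data.Empty using (⊥; ⊥-elim)
open import Data.Fin using (Fin; zero; suc; toℕ; fromℕ<; #_; splitAt; join)
open import Data.Fin.Properties as Fin using (_≟_)
open import Data.List as List using (List; []; _∷_; _++_; length; map; filter; concatMap; cartesianProduct; allFin; replicate)
open import Data.List.Membership.Propositional using (_∈_; _∉_; lose)
open import Data.List.Membership.Propositional.Properties using (∈-∃++; ∈-++⁻; ∈-++⁺ˡ; ∈-++⁺ʳ; ∈-map⁺; ∈-map⁻; ∈-filter⁺; ∈-filter⁻; ∈-allFin; ∈-concatMap⁺; ∈-cartesianProduct⁺; ∈-cartesianProduct⁻; ∈-lookup)
open import Data.List.Properties using (length-++; length-map; length-filter; length-tabulate; ≡-dec)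
open import Data.List.Relation.Binary.Permutation.Propositional as ↭ using (_↭_; prep; swap; ↭-refl; ↭-sym; ↭-trans)
import Data.List.Relation.Unary.All as All
open import Data.List.Relation.Unary.AllPairs using ([]; _∷_)
open import Data.List.Relation.Unary.Any as Any using (here; there)
open import Data.List.Relation.Unary.Any.Properties using (lookup-index)
open import Data.List.Relation.Unary.Unique.Propositional using (Unique)
import Data.List.Relation.Unary.Unique.Propositional.Properties as Unique
open import Data.Nat using (ℕ; zero; suc; _+_; _*_; _∸_; _^_; _%_; _/_; _≤_; _<_; z≤n; s≤s; _≤?_; _<?_; NonZero; >-nonZero)
open import Data.Nat.DivMod using (m/n≡1+[m∸n]/n; m≤n⇒[n∸m]%m≡n%m; m≡m%n+[m/n]*n; m≥n⇒m/n>0)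
open import Data.Nat.ListAction using (sum; product)
open import Data.Nat.Properties as ℕ using ()
open import Data.Nat.Tactic.RingSolver using (solve-∀)
open import Data.List.Sort.InsertionSort.Base ℕ.≤-decTotalOrder using (sort)
open import Data.List.Sort.InsertionSort.Properties ℕ.≤-decTotalOrder using (sort-↭)
open import Data.Product using (∃; _×_; _,_; proj₁; proj₂)
open import Data.Sum using (_⊎_; inj₁; inj₂; [_,_]′)
open import Data.Sum.Properties using (inj₁-injective; inj₂-injective)
open import Data.Unit using (⊤; tt)
open import Data.Vec using (Vec; []; _∷_; lookup; tabulate)
open import Data.Vec.Properties using (lookup∘tabulate; tabulate∘lookup; tabulate-cong; ∷-injectiveʳ)
open import Function using (_∘_; id; case_of_)
open import Function.Bundles using (_⇔_; mk⇔; mk↔ₛ′; Equivalence; Inverse)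
open import Relation.Binary.PropositionalEquality using (_≡_; _≢_; refl; sym; trans; cong; cong₂; subst; subst₂; module ≡-Reasoning)
open import Relation.Nullary using (Dec; yes; no; ¬_; contradiction)
open import Relation.Nullary.Decidable using (⌊_⌋; True; map′; toWitness; fromWitness; _×-dec_; _⊎-dec_; _→-dec_; ¬?)
open import Relation.Unary using (Decidable)

-- Lists and counting

-- The first inequality is exact on K_4, K_5 and K_6, so by itself it can neither give strictness
-- nor identify the extremal graphs. Its slack comes from orders: W - N[u] - N[v] misses the d + 1
-- vertices of N[v], and one vertex more whenever u has a neighbour outside N[v]. With enough such
-- neighbours these extra vertices force strictness; with one or two the saving can be too small.
-- For d = 3 with two of them the sum at order 11 is 100 + 2·15 + 22 > 150. This is why few such
-- neighbours are treated as a cut. Every estimate is an inequality between values of one function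
-- of the order, which gains the factor ten per five vertices from order 8 on. For fixed d each is
-- therefore decided by finitely many orders; only large d needs an argument of its own. Vertex sets
-- inside one fixed graph replace induced subgraphs, so vertices are never relabelled during the
-- induction. Equality is propagated as a peeling of W into separated cliques, and it becomes an
-- isomorphism only at the end.

unique-head : {A : Set} {x : A} {xs : List A} → Unique (x ∷ xs) → x ∉ xs
unique-head (x≢ ∷ _) x∈xs = All.lookup x≢ x∈xs refl

unique-∷ : {A : Set} {x : A} {xs : List A} → x ∉ xs → Unique xs → Unique (x ∷ xs)
unique-∷ x∉ u = All.tabulate (λ y∈ x≡y → x∉ (subst (_∈ _) (sym x≡y) y∈)) ∷ u

-- Injections are given as relations because the image of a matching is found by case analysis on a
-- membership proof. Removing the image of the head from `ys` leaves the images of the other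
-- entries, by injectivity.
length-≤-by-relation : {A B : Set} (R : A → B → Set) {xs : List A} {ys : List B} → Unique xs →
  (∀ {x} → x ∈ xs → ∃ λ y → y ∈ ys × R x y) →
  (∀ {x x′ y} → x ∈ xs → x′ ∈ xs → R x y → R x′ y → x ≡ x′) →
  length xs ≤ length ys
length-≤-by-relation R {[]} _ _ _ = z≤n
length-≤-by-relation R {x ∷ xs} u@(_ ∷ uxs) total inj with total (here refl)
... | y , y∈ys , Rxy with ∈-∃++ y∈ys
... | ys₁ , ys₂ , refl = begin
    suc (length xs)                ≤⟨ s≤s (length-≤-by-relation R uxs total′ (λ p q → inj (there p) (there q))) ⟩
    suc (length (ys₁ ++ ys₂))      ≡⟨ cong suc (length-++ ys₁) ⟩
    suc (length ys₁ + length ys₂)  ≡⟨ ℕ.+-suc (length ys₁) (length ys₂) ⟨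
    length ys₁ + suc (length ys₂)  ≡⟨ length-++ ys₁ ⟨
    length (ys₁ ++ y ∷ ys₂)        ∎
  where
  open ℕ.≤-Reasoning
  total′ : ∀ {x′} → x′ ∈ xs → ∃ λ z → z ∈ ys₁ ++ ys₂ × R x′ z
  total′ {x′} x′∈ with total (there x′∈)
  ... | z , z∈ , Rx′z with ∈-++⁻ ys₁ z∈
  ... | inj₁ p = z , ∈-++⁺ˡ p , Rx′z
  ... | inj₂ (there p) = z , ∈-++⁺ʳ ys₁ p , Rx′z
  ... | inj₂ (here refl) =
    contradiction (subst (_∈ xs) (inj (there x′∈) (here refl) Rx′z Rxy) x′∈) (unique-head u)

length-≤-by-⊆ : {A : Set} {xs ys : List A} → Unique xs → (∀ {x} → x ∈ xs → x ∈ ys) → length xs ≤ length ys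
length-≤-by-⊆ u xs⊆ys = length-≤-by-relation _≡_ u (λ x∈ → _ , xs⊆ys x∈ , refl) (λ { _ _ refl refl → refl })

length-concatMap : {A B : Set} (h : A → List B) (xs : List A) →
  length (concatMap h xs) ≡ sum (map (length ∘ h) xs)
length-concatMap h [] = refl
length-concatMap h (x ∷ xs) = trans (length-++ (h x)) (cong (length (h x) +_) (length-concatMap h xs))

length-cartesianProduct : {A B : Set} (xs : List A) (ys : List B) →
  length (cartesianProduct xs ys) ≡ length xs * length ys
length-cartesianProduct [] ys = refl
length-cartesianProduct (x ∷ xs) ys =
  trans (length-++ (map (x ,_) ys)) (cong₂ _+_ (length-map (x ,_) ys) (length-cartesianProduct xs ys))

module _ {A : Set} (h : A → ℕ) where

  sum-map-≤ : ∀ {b} xs → (∀ {x} → x ∈ xs → h x ≤ b) → sum (map h xs) ≤ length xs * b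
  sum-map-≤ [] _ = z≤n
  sum-map-≤ (x ∷ xs) h≤ = ℕ.+-mono-≤ (h≤ (here refl)) (sum-map-≤ xs (h≤ ∘ there))

  -- Entries satisfying `P` are charged `b` until `k` of them are spent; all remaining entries are
  -- charged `a`.
  sum-map-≤-split : {P : A → Set} (P? : Decidable P) {a b : ℕ} (k r : ℕ) (xs : List A) →
    (∀ {x} → x ∈ xs → h x ≤ a) → (∀ {x} → x ∈ xs → P x → h x ≤ b) →
    k ≤ length (filter P? xs) → length xs ≡ k + r → sum (map h xs) ≤ k * b + r * a
  sum-map-≤-split P? zero r xs ≤a ≤b k≤ eq rewrite sym eq = sum-map-≤ xs ≤a
  sum-map-≤-split P? {a} {b} (suc k) r (x ∷ xs) ≤a ≤b k≤ eq with P? x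
  ... | yes p = begin
      h x + sum (map h xs)   ≤⟨ ℕ.+-mono-≤ (≤b (here refl) p)
                                  (sum-map-≤-split P? k r xs (≤a ∘ there) (≤b ∘ there) (ℕ.≤-pred k≤) (ℕ.suc-injective eq)) ⟩
      b + (k * b + r * a)    ≡⟨ ℕ.+-assoc b (k * b) (r * a) ⟨
      b + k * b + r * a      ∎
    where open ℕ.≤-Reasoning
  sum-map-≤-split P? {a} {b} (suc k) zero (x ∷ xs) ≤a ≤b k≤ eq | no ¬p =
    contradiction (ℕ.≤-trans k≤ (length-filter P? xs))
      (ℕ.<⇒≱ (s≤s (ℕ.≤-reflexive (trans (ℕ.suc-injective eq) (ℕ.+-identityʳ k)))))
  sum-map-≤-split P? {a} {b} (suc k) (suc r) (x ∷ xs) ≤a ≤b k≤ eq | no ¬p = begin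
      h x + sum (map h xs)       ≤⟨ ℕ.+-mono-≤ (≤a (here refl))
                                     (sum-map-≤-split P? (suc k) r xs (≤a ∘ there) (≤b ∘ there) k≤
                                       (trans (ℕ.suc-injective eq) (ℕ.+-suc k r))) ⟩
      a + (suc k * b + r * a)    ≡⟨ ℕ.+-assoc a (suc k * b) (r * a) ⟨
      a + suc k * b + r * a      ≡⟨ cong (_+ r * a) (ℕ.+-comm a (suc k * b)) ⟩
      suc k * b + a + r * a      ≡⟨ ℕ.+-assoc (suc k * b) a (r * a) ⟩
      suc k * b + suc r * a      ∎
    where open ℕ.≤-Reasoning

  sum-map-≤-except : {a b : ℕ} {z : A} (xs : List A) → z ∈ xs → h z ≤ b → (∀ {x} → x ∈ xs → h x ≤ a) →
    sum (map h xs) ≤ b + (length xs ∸ 1) * a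
  sum-map-≤-except (x ∷ xs) (here refl) hz≤b ≤a = ℕ.+-mono-≤ hz≤b (sum-map-≤ xs (≤a ∘ there))
  sum-map-≤-except {a} {b} (x ∷ y ∷ ys) (there z∈) hz≤b ≤a = begin
      h x + sum (map h (y ∷ ys))  ≤⟨ ℕ.+-mono-≤ (≤a (here refl)) (sum-map-≤-except (y ∷ ys) z∈ hz≤b (≤a ∘ there)) ⟩
      a + (b + length ys * a)     ≡⟨ ℕ.+-assoc a b _ ⟨
      a + b + length ys * a       ≡⟨ cong (_+ length ys * a) (ℕ.+-comm a b) ⟩
      b + a + length ys * a       ≡⟨ ℕ.+-assoc b a _ ⟩
      b + suc (length ys) * a     ∎
    where open ℕ.≤-Reasoning

  maximiser : ∀ x xs → ∃ λ m → m ∈ x ∷ xs × (∀ {y} → y ∈ x ∷ xs → h y ≤ h m)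
  maximiser x [] = x , here refl , λ { (here refl) → ℕ.≤-refl }
  maximiser x (y ∷ ys) with maximiser y ys
  ... | m , m∈ , max with ℕ.≤-total (h x) (h m)
  ... | inj₁ hx≤hm = m , there m∈ , λ { (here refl) → hx≤hm ; (there p) → max p }
  ... | inj₂ hm≤hx = x , here refl , λ { (here refl) → ℕ.≤-refl ; (there p) → ℕ.≤-trans (max p) hm≤hx }

-- The bound

-- The maximum for graphs of order n, except that the maximum for order 7 is 21: the value 22 makes every estimate
-- at that order strict, so that no extremal graph has to be identified there.
bound : ℕ → ℕ
bound 0 = 1
bound 1 = 1
bound 2 = 1
bound 3 = 3
bound 4 = 6
bound 5 = 10
bound 6 = 15
bound 7 = 22
bound 8 = 36
bound 9 = 60
bound 10 = 100
bound 11 = 150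
bound 12 = 225
bound (suc (suc (suc (suc (suc n@(suc (suc (suc (suc (suc (suc (suc (suc _))))))))))))) = 10 * bound n

-- Clique orders of the extremal graph; the value [] is junk at 1, 2, 3 and 7.
sizes : ℕ → List ℕ
sizes 4 = 4 ∷ []
sizes 5 = 5 ∷ []
sizes 6 = 6 ∷ []
sizes 8 = 4 ∷ 4 ∷ []
sizes 9 = 4 ∷ 5 ∷ []
sizes 10 = 5 ∷ 5 ∷ []
sizes 11 = 6 ∷ 5 ∷ []
sizes 12 = 6 ∷ 6 ∷ []
sizes (suc (suc (suc (suc (suc n@(suc (suc (suc (suc (suc (suc (suc (suc _))))))))))))) = 5 ∷ sizes n
sizes _ = []

*-exchange : ∀ c x → c * (10 * x) ≡ 10 * (c * x)
*-exchange = solve-∀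

-- Syntax for the combinations of shifted values of `bound` that occur in the estimates, so that
-- periodicity is proved once, by recursion on the expression.
data BoundExpr : Set where
  shift : ℕ → BoundExpr
  _⊕_   : BoundExpr → BoundExpr → BoundExpr
  _⊗_   : ℕ → BoundExpr → BoundExpr

infixr 6 _⊕_
infixr 7 _⊗_

⟦_⟧ : BoundExpr → ℕ → ℕ
⟦ shift s ⟧ m = bound (s + m)
⟦ e ⊕ e′ ⟧ m = ⟦ e ⟧ m + ⟦ e′ ⟧ m
⟦ c ⊗ e ⟧ m = c * ⟦ e ⟧ m

⟦⟧-periodic : ∀ e m → ⟦ e ⟧ (13 + m) ≡ 10 * ⟦ e ⟧ (8 + m)
⟦⟧-periodic (shift s) m = trans (cong bound (swap₁ s m)) (cong (λ k → 10 * bound k) (swap₂ s m))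
  where
  swap₁ : ∀ s m → s + (13 + m) ≡ 13 + (s + m)
  swap₁ = solve-∀
  swap₂ : ∀ s m → 8 + (s + m) ≡ s + (8 + m)
  swap₂ = solve-∀
⟦⟧-periodic (e ⊕ e′) m = trans (cong₂ _+_ (⟦⟧-periodic e m) (⟦⟧-periodic e′ m)) (sym (ℕ.*-distribˡ-+ 10 (⟦ e ⟧ (8 + m)) _))
⟦⟧-periodic (c ⊗ e) m = trans (cong (c *_) (⟦⟧-periodic e m)) (*-exchange c (⟦ e ⟧ (8 + m)))

-- The period starts only at 8: `bound 12` is 225, coming from two copies of K_6, and exceeds ten
-- times `bound 7`.
from-8 : (P : ℕ → Set) → P 8 → P 9 → P 10 → P 11 → P 12 → (∀ m → P (8 + m) → P (13 + m)) → ∀ m → P (8 + m)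
from-8 P p₈ p₉ p₁₀ p₁₁ p₁₂ step = go
  where
  go : ∀ m → P (8 + m)
  go 0 = p₈
  go 1 = p₉
  go 2 = p₁₀
  go 3 = p₁₁
  go 4 = p₁₂
  go (suc (suc (suc (suc (suc m))))) = step m (go m)

periodic-induction : (P : ℕ → Set) → (∀ (i : Fin 13) → P (toℕ i)) → (∀ m → P (8 + m) → P (13 + m)) → ∀ n → P n
periodic-induction P base step = go
  where
  go : ∀ n → P n
  go 0 = base (# 0)
  go 1 = base (# 1)
  go 2 = base (# 2)
  go 3 = base (# 3)
  go 4 = base (# 4)
  go 5 = base (# 5)
  go 6 = base (# 6)
  go 7 = base (# 7)
  go (suc (suc (suc (suc (suc (suc (suc (suc m)))))))) =
    from-8 P (base (# 8)) (base (# 9)) (base (# 10)) (base (# 11)) (base (# 12)) step m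

-- Both sides of an inequality between such expressions are multiplied by ten when m grows by five, so 13 values decide it.
check-< : ∀ e e′ → {True (Fin.all? {13} (λ i → ⟦ e ⟧ (toℕ i) <? ⟦ e′ ⟧ (toℕ i)))} → ∀ m → ⟦ e ⟧ m < ⟦ e′ ⟧ m
check-< e e′ {ok} = periodic-induction (λ m → ⟦ e ⟧ m < ⟦ e′ ⟧ m) (toWitness ok)
  λ m ih → subst₂ _<_ (sym (⟦⟧-periodic e m)) (sym (⟦⟧-periodic e′ m)) (ℕ.*-monoʳ-< 10 ih)

check-≤ : ∀ e e′ → {True (Fin.all? {13} (λ i → ⟦ e ⟧ (toℕ i) ≤? ⟦ e′ ⟧ (toℕ i)))} → ∀ m → ⟦ e ⟧ m ≤ ⟦ e′ ⟧ m
check-≤ e e′ {ok} = periodic-induction (λ m → ⟦ e ⟧ m ≤ ⟦ e′ ⟧ m) (toWitness ok)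
  λ m ih → subst₂ _≤_ (sym (⟦⟧-periodic e m)) (sym (⟦⟧-periodic e′ m)) (ℕ.*-monoʳ-≤ 10 ih)

bound-mono-+ : ∀ k m → bound m ≤ bound (k + m)
bound-mono-+ zero m = ℕ.≤-refl
bound-mono-+ (suc k) m = ℕ.≤-trans (bound-mono-+ k m) (check-≤ (shift 0) (shift 1) (k + m))

bound-mono : ∀ {a b} → a ≤ b → bound a ≤ bound b
bound-mono {a} a≤b with ℕ.m≤n⇒∃[o]m+o≡n a≤b
... | k , refl = subst (λ b → bound a ≤ bound b) (ℕ.+-comm k a) (bound-mono-+ k a)

bound-positive : ∀ m → 1 ≤ bound m
bound-positive m = bound-mono {0} {m} z≤n

-- The factor 3 serves `bound-large-degree`: from order 7 on, one more vertex multiplies `bound` by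
-- at least 4/3, which leaves a third of the previous value for the branching terms. The degree is
-- unbounded, so the proof is by induction in steps of five: the right side gains a factor of at
-- least ten, the linear coefficient less.
3d*bound<bound : ∀ d m → 3 * (7 + d) * bound m < bound (7 + d + m)
3d*bound<bound 0 m = check-< (21 ⊗ shift 0) (shift 7) m
3d*bound<bound 1 m = check-< (24 ⊗ shift 0) (shift 8) m
3d*bound<bound 2 m = check-< (27 ⊗ shift 0) (shift 9) m
3d*bound<bound 3 m = check-< (30 ⊗ shift 0) (shift 10) m
3d*bound<bound 4 m = check-< (33 ⊗ shift 0) (shift 11) m
3d*bound<bound (suc (suc (suc (suc (suc d))))) m = begin-strict
  -- The slack `174 + 27 * d` is the difference between 30(7 + d) and 3(12 + d).
  3 * (12 + d) * bound m          ≤⟨ ℕ.*-monoˡ-≤ (bound m) (ℕ.≤-trans (ℕ.m≤m+n _ (174 + 27 * d)) (ℕ.≤-reflexive (arith d))) ⟩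
  10 * (3 * (7 + d)) * bound m    ≡⟨ ℕ.*-assoc 10 (3 * (7 + d)) (bound m) ⟩
  10 * (3 * (7 + d) * bound m)    <⟨ ℕ.*-monoʳ-< 10 (3d*bound<bound d m) ⟩
  10 * bound (7 + (d + m))        ≤⟨ check-≤ (10 ⊗ shift 7) (shift 12) (d + m) ⟩
  bound (12 + (d + m))            ∎
  where
  open ℕ.≤-Reasoning
  arith : ∀ d → 3 * (12 + d) + (174 + 27 * d) ≡ 10 * (3 * (7 + d))
  arith = solve-∀

-- Degree 6 is checked directly, because 3·6·`bound 0` exceeds `bound 6` and the argument with
-- factor 3 starts at degree 7.
bound-large-degree : ∀ d m → bound (6 + d + m) + (6 + d) * bound m < bound (7 + d + m)
bound-large-degree zero m = check-< (shift 6 ⊕ 6 ⊗ shift 0) (shift 7) m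
bound-large-degree (suc d) m = ℕ.*-cancelˡ-< 3 _ _ (begin-strict
  3 * (bound (7 + d + m) + (7 + d) * bound m)      ≡⟨ arith (bound (7 + d + m)) (7 + d) (bound m) ⟩
  3 * bound (7 + d + m) + 3 * (7 + d) * bound m    <⟨ ℕ.+-monoʳ-< (3 * bound (7 + d + m)) (3d*bound<bound d m) ⟩
  3 * bound (7 + d + m) + bound (7 + d + m)        ≤⟨ check-≤ (3 ⊗ shift 7 ⊕ shift 7) (3 ⊗ shift 8) (d + m) ⟩
  3 * bound (8 + d + m)                            ∎)
  where
  open ℕ.≤-Reasoning
  arith : ∀ x y z → 3 * (x + y * z) ≡ 3 * x + 3 * y * z
  arith = solve-∀

-- The orders at which equality with the bound forces the cliques in sizes (vacuously so at 7).
Determined : ℕ → Set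
Determined m = m ≡ 0 ⊎ 4 ≤ m

-- What can happen when a component of order s with at most c matchings is added to a set of order
-- m: either the bound is missed and nothing has to be identified, or it may be attained, and then
-- the clique orders must fit together.
AddClique : ℕ → ℕ → ℕ → Set
AddClique s c m = c * bound m < bound (s + m)
  ⊎ c * bound m ≤ bound (s + m) × Determined m × (s ∷ sizes m) ↭ sizes (s + m)

add-clique-step : ∀ s c m → AddClique s c (8 + m) → AddClique s c (13 + m)
-- With s moved inward the total order shows its 8 or 13 successors, so the last clauses of `bound`
-- and `sizes` compute.
add-clique-step s c m = subst₂ Lifted (rearrange 8 s m) (rearrange 13 s m) lift
  where
  rearrange : ∀ k s m → k + (s + m) ≡ s + (k + m)
  rearrange = solve-∀
  Holds : ℕ → ℕ → Set
  Holds k total = c * bound k < bound total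
    ⊎ c * bound k ≤ bound total × Determined k × (s ∷ sizes k) ↭ sizes total
  Lifted : ℕ → ℕ → Set
  Lifted t t′ = Holds (8 + m) t → Holds (13 + m) t′
  lift : Lifted (8 + (s + m)) (13 + (s + m))
  lift (inj₁ lt) = inj₁ (subst (_< bound (13 + (s + m))) (sym (*-exchange c (bound (8 + m)))) (ℕ.*-monoʳ-< 10 lt))
  lift (inj₂ (le , _ , perm)) = inj₂
    ( subst (_≤ bound (13 + (s + m))) (sym (*-exchange c (bound (8 + m)))) (ℕ.*-monoʳ-≤ 10 le)
    , inj₂ (ℕ.m≤m+n 4 (9 + m))
    , ↭-trans (swap s 5 ↭-refl) (prep 5 perm))

-- The permutation is replaced by equality of sorted lists, which is decidable.
add-clique? : ∀ s c m → Dec (c * bound m < bound (s + m)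
  ⊎ c * bound m ≤ bound (s + m) × Determined m × sort (s ∷ sizes m) ≡ sort (sizes (s + m)))
add-clique? s c m = (c * bound m <? bound (s + m)) ⊎-dec
  (c * bound m ≤? bound (s + m)) ×-dec ((m ℕ.≟ 0) ⊎-dec (4 ≤? m)) ×-dec ≡-dec ℕ._≟_ _ _

add-clique : ∀ s c → {True (Fin.all? {13} (λ i → add-clique? s c (toℕ i)))} → ∀ m → AddClique s c m
add-clique s c {ok} = periodic-induction (AddClique s c) base (add-clique-step s c)
  where
  base : ∀ i → AddClique s c (toℕ i)
  base i with toWitness ok i
  ... | inj₁ lt = inj₁ lt
  ... | inj₂ (le , det , eq) = inj₂ (le , det ,
    ↭-trans (↭-sym (sort-↭ _)) (subst (_↭ sizes (s + toℕ i)) (sym eq) (sort-↭ (sizes (s + toℕ i)))))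

choose₂ : ℕ → ℕ
choose₂ zero = 0
choose₂ (suc k) = k + choose₂ k

in-range : ∀ {k j} → 2 ≤ j → j < 2 + k → ∃ λ (i : Fin k) → j ≡ 2 + toℕ i
in-range {k} {suc (suc j)} (s≤s (s≤s _)) (s≤s (s≤s j<k)) = fromℕ< j<k , cong (2 +_) (sym (Fin.toℕ-fromℕ< j<k))

-- OneOpen, TwoOpen and ManyOpen compare the branching sums with the bound: d is the maximum degree, attained
-- at v, and one, two or at least k neighbours of v have a neighbour outside N[v]; j and j′ are the degrees of the
-- first two of these (the second one counted after the first has been deleted).
OneOpen : ℕ → Set
OneOpen d = ∀ {N j} → 2 ≤ j → j ≤ d → 2 + d ≤ N →
  bound d * bound (N ∸ suc d) + (bound (N ∸ (2 + d)) + (j ∸ 1) * bound (N ∸ suc j)) < bound N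

TwoOpen : ℕ → Set
TwoOpen d = ∀ {N j j′} → 2 ≤ j → j ≤ d → 2 ≤ j′ → j′ ≤ d → 2 + d ≤ N →
  bound (d ∸ 1) * bound (N ∸ suc d) + (bound (N ∸ (2 + d)) + (j′ ∸ 1) * bound (N ∸ (2 + j′)))
    + (bound (N ∸ (2 + d)) + (j ∸ 1) * bound (N ∸ suc j)) < bound N

-- Here and in the tables below, N = 2 + d + m. The shifts are what the truncated subtractions leave
-- of N, and the coefficients are the value of `bound` on the remainder of N[v] and the numbers
-- `j ∸ 1`, `j′ ∸ 1`.
one-open₂ : OneOpen 2
one-open₂ 2≤j j≤d 2+d≤N with in-range {1} 2≤j (s≤s j≤d) | ℕ.m≤n⇒∃[o]m+o≡n 2+d≤N
... | zero , refl | m , refl = check-< (1 ⊗ shift 1 ⊕ shift 0 ⊕ 1 ⊗ shift 1) (shift 4) m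

one-open₃ : OneOpen 3
one-open₃ 2≤j j≤d 2+d≤N with in-range {2} 2≤j (s≤s j≤d) | ℕ.m≤n⇒∃[o]m+o≡n 2+d≤N
... | zero , refl | m , refl = check-< (3 ⊗ shift 1 ⊕ shift 0 ⊕ 1 ⊗ shift 2) (shift 5) m
... | suc zero , refl | m , refl = check-< (3 ⊗ shift 1 ⊕ shift 0 ⊕ 2 ⊗ shift 1) (shift 5) m

one-open₄ : OneOpen 4
one-open₄ 2≤j j≤d 2+d≤N with in-range {3} 2≤j (s≤s j≤d) | ℕ.m≤n⇒∃[o]m+o≡n 2+d≤N
... | zero , refl | m , refl = check-< (6 ⊗ shift 1 ⊕ shift 0 ⊕ 1 ⊗ shift 3) (shift 6) m
... | suc zero , refl | m , refl = check-< (6 ⊗ shift 1 ⊕ shift 0 ⊕ 2 ⊗ shift 2) (shift 6) m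
... | suc (suc zero) , refl | m , refl = check-< (6 ⊗ shift 1 ⊕ shift 0 ⊕ 3 ⊗ shift 1) (shift 6) m

two-open₃ : TwoOpen 3
two-open₃ 2≤j j≤d 2≤j′ j′≤d 2+d≤N
  with in-range {2} 2≤j (s≤s j≤d) | in-range {2} 2≤j′ (s≤s j′≤d) | ℕ.m≤n⇒∃[o]m+o≡n 2+d≤N
... | zero , refl | zero , refl | m , refl =
  check-< ((1 ⊗ shift 1 ⊕ shift 0 ⊕ 1 ⊗ shift 1) ⊕ shift 0 ⊕ 1 ⊗ shift 2) (shift 5) m
... | zero , refl | suc zero , refl | m , refl =
  check-< ((1 ⊗ shift 1 ⊕ shift 0 ⊕ 2 ⊗ shift 0) ⊕ shift 0 ⊕ 1 ⊗ shift 2) (shift 5) m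
... | suc zero , refl | zero , refl | m , refl =
  check-< ((1 ⊗ shift 1 ⊕ shift 0 ⊕ 1 ⊗ shift 1) ⊕ shift 0 ⊕ 2 ⊗ shift 1) (shift 5) m
... | suc zero , refl | suc zero , refl | m , refl =
  check-< ((1 ⊗ shift 1 ⊕ shift 0 ⊕ 2 ⊗ shift 0) ⊕ shift 0 ⊕ 2 ⊗ shift 1) (shift 5) m

two-open₄ : TwoOpen 4
two-open₄ 2≤j j≤d 2≤j′ j′≤d 2+d≤N
  with in-range {3} 2≤j (s≤s j≤d) | in-range {3} 2≤j′ (s≤s j′≤d) | ℕ.m≤n⇒∃[o]m+o≡n 2+d≤N
... | zero , refl | zero , refl | m , refl =
  check-< ((3 ⊗ shift 1 ⊕ shift 0 ⊕ 1 ⊗ shift 2) ⊕ shift 0 ⊕ 1 ⊗ shift 3) (shift 6) m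
... | zero , refl | suc zero , refl | m , refl =
  check-< ((3 ⊗ shift 1 ⊕ shift 0 ⊕ 2 ⊗ shift 1) ⊕ shift 0 ⊕ 1 ⊗ shift 3) (shift 6) m
... | zero , refl | suc (suc zero) , refl | m , refl =
  check-< ((3 ⊗ shift 1 ⊕ shift 0 ⊕ 3 ⊗ shift 0) ⊕ shift 0 ⊕ 1 ⊗ shift 3) (shift 6) m
... | suc zero , refl | zero , refl | m , refl =
  check-< ((3 ⊗ shift 1 ⊕ shift 0 ⊕ 1 ⊗ shift 2) ⊕ shift 0 ⊕ 2 ⊗ shift 2) (shift 6) m
... | suc zero , refl | suc zero , refl | m , refl =
  check-< ((3 ⊗ shift 1 ⊕ shift 0 ⊕ 2 ⊗ shift 1) ⊕ shift 0 ⊕ 2 ⊗ shift 2) (shift 6) m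
... | suc zero , refl | suc (suc zero) , refl | m , refl =
  check-< ((3 ⊗ shift 1 ⊕ shift 0 ⊕ 3 ⊗ shift 0) ⊕ shift 0 ⊕ 2 ⊗ shift 2) (shift 6) m
... | suc (suc zero) , refl | zero , refl | m , refl =
  check-< ((3 ⊗ shift 1 ⊕ shift 0 ⊕ 1 ⊗ shift 2) ⊕ shift 0 ⊕ 3 ⊗ shift 1) (shift 6) m
... | suc (suc zero) , refl | suc zero , refl | m , refl =
  check-< ((3 ⊗ shift 1 ⊕ shift 0 ⊕ 2 ⊗ shift 1) ⊕ shift 0 ⊕ 3 ⊗ shift 1) (shift 6) m
... | suc (suc zero) , refl | suc (suc zero) , refl | m , refl =
  check-< ((3 ⊗ shift 1 ⊕ shift 0 ⊕ 3 ⊗ shift 0) ⊕ shift 0 ⊕ 3 ⊗ shift 1) (shift 6) m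

ManyOpen : ℕ → ℕ → ℕ → Set
ManyOpen d k r = ∀ {N} → 2 + d ≤ N → bound (N ∸ 1) + (k * bound (N ∸ (2 + d)) + r * bound (N ∸ (1 + d))) < bound N

many-open₂ : ManyOpen 2 2 0
many-open₂ 2+d≤N with ℕ.m≤n⇒∃[o]m+o≡n 2+d≤N
... | m , refl = check-< (shift 3 ⊕ 2 ⊗ shift 0 ⊕ 0 ⊗ shift 1) (shift 4) m

many-open₃ : ManyOpen 3 3 0
many-open₃ 2+d≤N with ℕ.m≤n⇒∃[o]m+o≡n 2+d≤N
... | m , refl = check-< (shift 4 ⊕ 3 ⊗ shift 0 ⊕ 0 ⊗ shift 1) (shift 5) m

-- Two open neighbours would not do: at order 11 they give 100 + 2·10 + 2·15 = 150, exactly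
-- `bound 11`.
many-open₄ : ManyOpen 4 3 1
many-open₄ 2+d≤N with ℕ.m≤n⇒∃[o]m+o≡n 2+d≤N
... | m , refl = check-< (shift 5 ⊕ 3 ⊗ shift 0 ⊕ 1 ⊗ shift 1) (shift 6) m

-- One open neighbour is what breaks the tie: with none, order 12 gives 150 + 5·15 = 225, the value
-- of two copies of K_6.
many-open₅ : ManyOpen 5 1 4
many-open₅ 2+d≤N with ℕ.m≤n⇒∃[o]m+o≡n 2+d≤N
... | m , refl = check-< (shift 6 ⊕ 1 ⊗ shift 0 ⊕ 4 ⊗ shift 1) (shift 7) m

large-degree : ∀ e {N} → 6 + e < N → bound (N ∸ 1) + (6 + e) * bound (N ∸ (7 + e)) < bound N
large-degree e d<N with ℕ.m≤n⇒∃[o]m+o≡n d<N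
... | m , refl = subst (λ k → bound (6 + e + m) + (6 + e) * bound k < bound (7 + e + m))
  (sym (ℕ.m+n∸m≡n (7 + e) m)) (bound-large-degree e m)

-- The left side is the branching sum, inside a component N[v] of order d + 1, at a vertex a of
-- degree j < d. Partner v leaves nothing, which accounts for the 1; each other partner leaves at
-- most d - j vertices.
NonCliqueGap : ℕ → ℕ → Set
NonCliqueGap d j = bound d + (1 + (j ∸ 1) * bound (d ∸ j)) < choose₂ (1 + d)

non-clique-gap : ∀ d → {True (Fin.all? {d} λ j → bound d + (1 + (toℕ j ∸ 1) * bound (d ∸ toℕ j)) <? choose₂ (1 + d))} →
  ∀ j → j < d → NonCliqueGap d j
non-clique-gap d {ok} j j<d = subst (NonCliqueGap d) (Fin.toℕ-fromℕ< j<d) (toWitness ok (fromℕ< j<d))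

-- Vertex sets and maximal induced matchings

subsets : ∀ n → List (Vec Bool n)
subsets zero = [] ∷ []
subsets (suc n) = map (true ∷_) (subsets n) ++ map (false ∷_) (subsets n)

∈-subsets : ∀ {n} (U : Vec Bool n) → U ∈ subsets n
∈-subsets [] = here refl
∈-subsets (true ∷ U) = ∈-++⁺ˡ (∈-map⁺ _ (∈-subsets U))
∈-subsets {suc n} (false ∷ U) = ∈-++⁺ʳ (map (true ∷_) (subsets n)) (∈-map⁺ _ (∈-subsets U))

subsets-unique : ∀ n → Unique (subsets n)
subsets-unique zero = All.[] ∷ []
subsets-unique (suc n) = Unique.++⁺ (Unique.map⁺ ∷-injectiveʳ (subsets-unique n)) (Unique.map⁺ ∷-injectiveʳ (subsets-unique n))
  λ (p , q) → case ∈-map⁻ (true ∷_) p , ∈-map⁻ (false ∷_) q of λ { ((_ , _ , refl) , (_ , _ , ())) }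

T-ext : ∀ {a b} → (T a → T b) → (T b → T a) → a ≡ b
T-ext {true} {true} _ _ = refl
T-ext {true} {false} f _ = ⊥-elim (f tt)
T-ext {false} {true} _ g = ⊥-elim (g tt)
T-ext {false} {false} _ _ = refl

-- Ambient sets are compared by membership only, so functions suffice. Matchings are counted, hence
-- stored as vectors, for which equal membership yields equality.
VSet : ℕ → Set
VSet n = Fin n → Bool

infix 4 _∊_ _∋_

record _∊_ {n : ℕ} (x : Fin n) (W : VSet n) : Set where
  constructor in-set
  field holds : T (W x)

record _∋_ {n : ℕ} (U : Vec Bool n) (x : Fin n) : Set where
  constructor in-vec
  field holds : T (lookup U x)

_∊?_ : ∀ {n} (x : Fin n) (W : VSet n) → Dec (x ∊ W)
x ∊? W = map′ in-set _∊_.holds (T? (W x))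

_∋?_ : ∀ {n} (U : Vec Bool n) (x : Fin n) → Dec (U ∋ x)
U ∋? x = map′ in-vec _∋_.holds (T? (lookup U x))

[_]ˢ : ∀ {n} {P : Fin n → Set} → Decidable P → VSet n
[ P? ]ˢ x = ⌊ P? x ⌋

[_]ᵛ : ∀ {n} {P : Fin n → Set} → Decidable P → Vec Bool n
[ P? ]ᵛ = tabulate (λ x → ⌊ P? x ⌋)

module _ {n : ℕ} {P : Fin n → Set} (P? : Decidable P) {x : Fin n} where

  ∊-comprehension⁺ : P x → x ∊ [ P? ]ˢ
  ∊-comprehension⁺ p = in-set (fromWitness {a? = P? x} p)

  ∊-comprehension⁻ : x ∊ [ P? ]ˢ → P x
  ∊-comprehension⁻ (in-set p) = toWitness {a? = P? x} p

  ∋-comprehension⁺ : P x → [ P? ]ᵛ ∋ x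
  ∋-comprehension⁺ p = in-vec (subst T (sym (lookup∘tabulate (λ x → ⌊ P? x ⌋) x)) (fromWitness {a? = P? x} p))

  ∋-comprehension⁻ : [ P? ]ᵛ ∋ x → P x
  ∋-comprehension⁻ (in-vec p) = toWitness {a? = P? x} (subst T (lookup∘tabulate (λ x → ⌊ P? x ⌋) x) p)

module _ {n : ℕ} where

  private
    diff? : (W X : VSet n) → Decidable (λ x → x ∊ W × ¬ x ∊ X)
    diff? W X x = (x ∊? W) ×-dec ¬? (x ∊? X)

    delete? : (W : VSet n) (v : Fin n) → Decidable (λ x → x ∊ W × x ≢ v)
    delete? W v x = (x ∊? W) ×-dec ¬? (x ≟ v)

    inter? : (U : Vec Bool n) (X : VSet n) → Decidable (λ x → U ∋ x × x ∊ X)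
    inter? U X x = (U ∋? x) ×-dec (x ∊? X)

    union? : (U U′ : Vec Bool n) → Decidable (λ x → U ∋ x ⊎ U′ ∋ x)
    union? U U′ x = (U ∋? x) ⊎-dec (U′ ∋? x)

  abstract

    _∖_ : VSet n → VSet n → VSet n
    W ∖ X = [ diff? W X ]ˢ

    ∖⁺ : ∀ {W X x} → x ∊ W → ¬ x ∊ X → x ∊ W ∖ X
    ∖⁺ {W} {X} p q = ∊-comprehension⁺ (diff? W X) (p , q)

    ∖⁻ : ∀ {W X x} → x ∊ W ∖ X → x ∊ W × ¬ x ∊ X
    ∖⁻ {W} {X} = ∊-comprehension⁻ (diff? W X)

    _∖⁅_⁆ : VSet n → Fin n → VSet n
    W ∖⁅ v ⁆ = [ delete? W v ]ˢ

    ∖⁅⁆⁺ : ∀ {W v x} → x ∊ W → x ≢ v → x ∊ W ∖⁅ v ⁆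
    ∖⁅⁆⁺ {W} {v} p q = ∊-comprehension⁺ (delete? W v) (p , q)

    ∖⁅⁆⁻ : ∀ {W v x} → x ∊ W ∖⁅ v ⁆ → x ∊ W × x ≢ v
    ∖⁅⁆⁻ {W} {v} = ∊-comprehension⁻ (delete? W v)

    _∩ᵛ_ : Vec Bool n → VSet n → Vec Bool n
    U ∩ᵛ X = [ inter? U X ]ᵛ

    ∩ᵛ⁺ : ∀ {U X x} → U ∋ x → x ∊ X → U ∩ᵛ X ∋ x
    ∩ᵛ⁺ {U} {X} p q = ∋-comprehension⁺ (inter? U X) (p , q)

    ∩ᵛ⁻ : ∀ {U X x} → U ∩ᵛ X ∋ x → U ∋ x × x ∊ X
    ∩ᵛ⁻ {U} {X} = ∋-comprehension⁻ (inter? U X)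

    _∪ᵛ_ : Vec Bool n → Vec Bool n → Vec Bool n
    U ∪ᵛ U′ = [ union? U U′ ]ᵛ

    ∪ᵛ⁺ : ∀ {U U′ x} → U ∋ x ⊎ U′ ∋ x → U ∪ᵛ U′ ∋ x
    ∪ᵛ⁺ {U} {U′} = ∋-comprehension⁺ (union? U U′)

    ∪ᵛ⁻ : ∀ {U U′ x} → U ∪ᵛ U′ ∋ x → U ∋ x ⊎ U′ ∋ x
    ∪ᵛ⁻ {U} {U′} = ∋-comprehension⁻ (union? U U′)

  ∋-ext : ∀ {U U′ : Vec Bool n} → (∀ {x} → U ∋ x → U′ ∋ x) → (∀ {x} → U′ ∋ x → U ∋ x) → U ≡ U′
  ∋-ext {U} {U′} f g = trans (sym (tabulate∘lookup U))
    (trans (tabulate-cong λ x → T-ext (_∋_.holds ∘ f ∘ in-vec) (_∋_.holds ∘ g ∘ in-vec)) (tabulate∘lookup U′))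

  ∩ᵛ-determines : ∀ {U U′ : Vec Bool n} {X x} → U ∩ᵛ X ≡ U′ ∩ᵛ X → x ∊ X → U ∋ x → U′ ∋ x
  ∩ᵛ-determines {x = x} eq Xx Ux = proj₁ (∩ᵛ⁻ (subst (_∋ x) eq (∩ᵛ⁺ Ux Xx)))

elems : ∀ {n} → VSet n → List (Fin n)
elems W = filter (_∊? W) (allFin _)

card : ∀ {n} → VSet n → ℕ
card W = length (elems W)

module _ {n : ℕ} where

  ∈-elems⁺ : ∀ {W : VSet n} {x} → x ∊ W → x ∈ elems W
  ∈-elems⁺ {W} {x} = ∈-filter⁺ (_∊? W) (∈-allFin x)

  ∈-elems⁻ : ∀ {W : VSet n} {x} → x ∈ elems W → x ∊ W
  ∈-elems⁻ {W} p = proj₂ (∈-filter⁻ (_∊? W) {xs = allFin n} p)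

  elems-unique : ∀ (W : VSet n) → Unique (elems W)
  elems-unique W = Unique.filter⁺ (_∊? W) (Unique.allFin⁺ n)

  -- The order estimates for reduced sets rest on this: they exhibit distinct vertices that have
  -- disappeared.
  card-drop : ∀ {W X : VSet n} {ys} → (∀ {x} → x ∊ X → x ∊ W) →
    Unique ys → (∀ {y} → y ∈ ys → y ∊ W × ¬ y ∊ X) → length ys + card X ≤ card W
  card-drop {W} {X} {ys} X⊆W uys ys⊆ = begin
    length ys + card X          ≡⟨ length-++ ys ⟨
    length (ys ++ elems X)      ≤⟨ length-≤-by-⊆ {ys = elems W} (Unique.++⁺ uys (elems-unique X) λ (p , q) → proj₂ (ys⊆ p) (∈-elems⁻ q))
                                     (λ p → ∈-elems⁺ ([ (λ q → proj₁ (ys⊆ q)) , (λ q → X⊆W (∈-elems⁻ q)) ]′ (∈-++⁻ ys p))) ⟩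
    card W                      ∎
    where open ℕ.≤-Reasoning

  card-∖ : ∀ {W S : VSet n} → (∀ {x} → x ∊ S → x ∊ W) → card W ≡ card S + card (W ∖ S)
  card-∖ {W} {S} S⊆W = ℕ.≤-antisym
    (ℕ.≤-trans (length-≤-by-⊆ (elems-unique W) covered) (ℕ.≤-reflexive (length-++ (elems S))))
    (card-drop {W} {W ∖ S} (λ p → proj₁ (∖⁻ p)) (elems-unique S)
      (λ p → S⊆W (∈-elems⁻ p) , λ q → proj₂ (∖⁻ q) (∈-elems⁻ p)))
    where
    covered : ∀ {x} → x ∈ elems W → x ∈ elems S ++ elems (W ∖ S)
    covered {x} p with x ∊? S
    ... | yes q = ∈-++⁺ˡ (∈-elems⁺ q)
    ... | no ¬q = ∈-++⁺ʳ (elems S) (∈-elems⁺ (∖⁺ (∈-elems⁻ p) ¬q))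

module Matchings {n : ℕ} (G : Graph n) where

  edge-sym : ∀ {x y} → Edge G x y → Edge G y x
  edge-sym {x} {y} = subst T (adj-sym G x y)

  edge-irrefl : ∀ {x} → ¬ Edge G x x
  edge-irrefl {x} = subst T (adj-irrefl G x)

  edge? : ∀ x y → Dec (Edge G x y)
  edge? x y = T? (adj G x y)

  OneRegular : Vec Bool n → Set
  OneRegular U = ∀ x → U ∋ x → ∃ λ y → U ∋ y × Edge G x y × (∀ z → U ∋ z → Edge G x z → z ≡ y)

  -- An induced matching is encoded by the set U of its endpoints; no edge ab inside W can be added
  -- exactly when a or b has a neighbour in U.
  record IsMIM (W : VSet n) (U : Vec Bool n) : Set where
    constructor mim
    field
      inside     : ∀ {x} → U ∋ x → x ∊ W
      oneRegular : OneRegular U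
      maximal    : ∀ a b → a ∊ W → b ∊ W → Edge G a b → ∃ λ c → U ∋ c × (Edge G a c ⊎ Edge G b c)

  isMIM? : ∀ W → Decidable (IsMIM W)
  isMIM? W U = map′ (λ (p , q , r) → mim (p _) q r) (λ (mim p q r) → (λ _ → p) , q , r)
    (Fin.all? (λ x → (U ∋? x) →-dec (x ∊? W))
     ×-dec Fin.all? (λ x → (U ∋? x) →-dec Fin.any? (λ y → (U ∋? y) ×-dec edge? x y
             ×-dec Fin.all? (λ z → (U ∋? z) →-dec edge? x z →-dec (z ≟ y))))
     ×-dec Fin.all? (λ a → Fin.all? (λ b → (a ∊? W) →-dec (b ∊? W) →-dec edge? a b →-dec
             Fin.any? (λ c → (U ∋? c) ×-dec (edge? a c ⊎-dec edge? b c)))))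

  MIMs : VSet n → List (Vec Bool n)
  MIMs W = filter (isMIM? W) (subsets n)

  #MIM : VSet n → ℕ
  #MIM W = length (MIMs W)

  ∈-MIMs⁺ : ∀ {W U} → IsMIM W U → U ∈ MIMs W
  ∈-MIMs⁺ {W} {U} = ∈-filter⁺ (isMIM? W) (∈-subsets U)

  ∈-MIMs⁻ : ∀ {W U} → U ∈ MIMs W → IsMIM W U
  ∈-MIMs⁻ {W} p = proj₂ (∈-filter⁻ (isMIM? W) {xs = subsets n} p)

  MIMs-unique : ∀ W → Unique (MIMs W)
  MIMs-unique W = Unique.filter⁺ (isMIM? W) (subsets-unique n)

  -- If every neighbour in U of a vertex of X lies in X, then partners and blocking vertices survive
  -- the restriction, and with them regularity and maximality.
  restrict : ∀ {W X U} → IsMIM W U → (∀ {x} → x ∊ X → x ∊ W) →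
    (∀ {a b} → a ∊ X → U ∋ b → Edge G a b → b ∊ X) → IsMIM X (U ∩ᵛ X)
  restrict {W} {X} {U} (mim _ reg max) X⊆W stays = mim (proj₂ ∘ ∩ᵛ⁻) reg′ max′
    where
    reg′ : OneRegular (U ∩ᵛ X)
    reg′ x p with ∩ᵛ⁻ p
    ... | Ux , Xx with reg x Ux
    ... | y , Uy , xy , only = y , ∩ᵛ⁺ Uy (stays Xx Uy xy) , xy , λ z q → only z (proj₁ (∩ᵛ⁻ q))
    max′ : ∀ a b → a ∊ X → b ∊ X → Edge G a b → ∃ λ c → U ∩ᵛ X ∋ c × (Edge G a c ⊎ Edge G b c)
    max′ a b Xa Xb ab with max a b (X⊆W Xa) (X⊆W Xb) ab
    ... | c , Uc , inj₁ ac = c , ∩ᵛ⁺ Uc (stays Xa Uc ac) , inj₁ ac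
    ... | c , Uc , inj₂ bc = c , ∩ᵛ⁺ Uc (stays Xb Uc bc) , inj₂ bc

  Near : Fin n → Fin n → Set
  Near v x = x ≡ v ⊎ Edge G v x

  near? : ∀ v x → Dec (Near v x)
  near? v x = (x ≟ v) ⊎-dec edge? v x

  private
    far? : ∀ W u v → Decidable (λ x → x ∊ W × ¬ Near u x × ¬ Near v x)
    far? W u v x = (x ∊? W) ×-dec ¬? (near? u x) ×-dec ¬? (near? v x)

  abstract

    far : VSet n → Fin n → Fin n → VSet n
    far W u v = [ far? W u v ]ˢ

    far⁺ : ∀ {W u v x} → x ∊ W → ¬ Near u x → ¬ Near v x → x ∊ far W u v
    far⁺ {W} {u} {v} p q r = ∊-comprehension⁺ (far? W u v) (p , q , r)

    far⁻ : ∀ {W u v x} → x ∊ far W u v → x ∊ W × ¬ Near u x × ¬ Near v x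
    far⁻ {W} {u} {v} = ∊-comprehension⁻ (far? W u v)

  nbrs : VSet n → Fin n → List (Fin n)
  nbrs W v = filter (λ u → (u ∊? W) ×-dec edge? v u) (allFin n)

  deg : VSet n → Fin n → ℕ
  deg W v = length (nbrs W v)

  ∈-nbrs⁺ : ∀ {W v u} → u ∊ W → Edge G v u → u ∈ nbrs W v
  ∈-nbrs⁺ {W} {v} {u} p q = ∈-filter⁺ (λ u → (u ∊? W) ×-dec edge? v u) (∈-allFin u) (p , q)

  ∈-nbrs⁻ : ∀ {W v u} → u ∈ nbrs W v → u ∊ W × Edge G v u
  ∈-nbrs⁻ {W} {v} p = proj₂ (∈-filter⁻ (λ u → (u ∊? W) ×-dec edge? v u) {xs = allFin n} p)

  nbrs-unique : ∀ W v → Unique (nbrs W v)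
  nbrs-unique W v = Unique.filter⁺ (λ u → (u ∊? W) ×-dec edge? v u) (Unique.allFin⁺ n)

  module _ (W : VSet n) (v : Fin n) where

    private
      targets : List (Vec Bool n ⊎ Fin n × Vec Bool n)
      targets = map inj₁ (MIMs (W ∖⁅ v ⁆)) ++ map inj₂ (concatMap (λ u → map (u ,_) (MIMs (far W u v))) (nbrs W v))

      Reduces : Vec Bool n → Vec Bool n ⊎ Fin n × Vec Bool n → Set
      Reduces U (inj₁ U′) = U ≡ U′
      Reduces U (inj₂ (u , U′)) = U ∋ v × U ∋ u × Edge G v u × U′ ≡ U ∩ᵛ far W u v

      partner-unique : ∀ {U x y z} → OneRegular U → U ∋ x → U ∋ y → Edge G x y → U ∋ z → Edge G x z → z ≡ y
      partner-unique {x = x} reg Ux Uy xy Uz xz with reg x Ux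
      ... | _ , _ , _ , only = trans (only _ Uz xz) (sym (only _ Uy xy))

      -- In an induced matching u and v have only each other as neighbours among the endpoints, so
      -- every other endpoint avoids both closed neighbourhoods.
      lands-far : ∀ {U u x} → IsMIM W U → U ∋ v → U ∋ u → Edge G v u → U ∋ x → x ≢ u → x ≢ v → x ∊ far W u v
      lands-far (mim sub reg _) Uv Uu vu Ux x≢u x≢v = far⁺ (sub Ux)
        [ x≢u , (λ ux → x≢v (partner-unique reg Uu Uv (edge-sym vu) Ux ux)) ]′
        [ x≢v , (λ vx → x≢u (partner-unique reg Uv Uu vu Ux vx)) ]′

      total : ∀ {U} → U ∈ MIMs W → ∃ λ t → t ∈ targets × Reduces U t
      total {U} U∈ with ∈-MIMs⁻ U∈ | U ∋? v
      ... | m@(mim sub reg max) | no ¬Uv = inj₁ U , ∈-++⁺ˡ (∈-map⁺ inj₁ (∈-MIMs⁺ avoiding)) , refl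
        where
        avoiding : IsMIM (W ∖⁅ v ⁆) U
        avoiding = mim (λ Ux → ∖⁅⁆⁺ (sub Ux) λ { refl → ¬Uv Ux }) reg
          λ a b a∈ b∈ → max a b (proj₁ (∖⁅⁆⁻ a∈)) (proj₁ (∖⁅⁆⁻ b∈))
      ... | m@(mim sub reg max) | yes Uv with reg v Uv
      ... | u , Uu , vu , _ = inj₂ (u , U ∩ᵛ far W u v)
        , ∈-++⁺ʳ (map inj₁ (MIMs (W ∖⁅ v ⁆))) (∈-map⁺ inj₂ (∈-concatMap⁺ (λ u → map (u ,_) (MIMs (far W u v)))
            (lose (∈-nbrs⁺ (sub Uu) vu) (∈-map⁺ (u ,_) (∈-MIMs⁺ (restrict m (proj₁ ∘ far⁻) stays))))))
        , Uv , Uu , vu , refl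
        where
        stays : ∀ {a b} → a ∊ far W u v → U ∋ b → Edge G a b → b ∊ far W u v
        stays {a} {b} a∈ Ub ab = lands-far m Uv Uu vu Ub
          (λ { refl → proj₁ (proj₂ (far⁻ a∈)) (inj₂ (edge-sym ab)) })
          (λ { refl → proj₂ (proj₂ (far⁻ a∈)) (inj₂ (edge-sym ab)) })

      ⊆-from-far : ∀ {U U′ u} → IsMIM W U → U ∋ v → U ∋ u → Edge G v u → U′ ∋ v → U′ ∋ u →
        U ∩ᵛ far W u v ≡ U′ ∩ᵛ far W u v → ∀ {x} → U ∋ x → U′ ∋ x
      ⊆-from-far {U} {U′} {u} m Uv Uu vu U′v U′u eq {x} Ux with x ≟ u | x ≟ v
      ... | yes refl | _ = U′u
      ... | no _ | yes refl = U′v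
      ... | no x≢u | no x≢v = ∩ᵛ-determines eq (lands-far m Uv Uu vu Ux x≢u x≢v) Ux

      injective : ∀ {U U′ t} → U ∈ MIMs W → U′ ∈ MIMs W → Reduces U t → Reduces U′ t → U ≡ U′
      injective {t = inj₁ _} _ _ refl refl = refl
      injective {t = inj₂ (u , _)} U∈ U′∈ (Uv , Uu , vu , eq) (U′v , U′u , _ , eq′) = ∋-ext
        (⊆-from-far (∈-MIMs⁻ U∈) Uv Uu vu U′v U′u (trans (sym eq) eq′))
        (⊆-from-far (∈-MIMs⁻ U′∈) U′v U′u vu Uv Uu (trans (sym eq′) eq))

      sum-cong : {h h′ : Fin n → ℕ} (xs : List (Fin n)) → (∀ x → h x ≡ h′ x) → sum (map h xs) ≡ sum (map h′ xs)
      sum-cong [] eq = refl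
      sum-cong (x ∷ xs) eq = cong₂ _+_ (eq x) (sum-cong xs eq)

    -- A matching that avoids v stays maximal in W - v, where fewer edges have to be blocked. One
    -- that matches v to u is recovered from u and its trace on `far W u v`. Equality can fail,
    -- since a matching maximal in W - v may be extendable by an edge at v.
    branch : #MIM W ≤ #MIM (W ∖⁅ v ⁆) + sum (map (λ u → #MIM (far W u v)) (nbrs W v))
    branch = begin
      #MIM W            ≤⟨ length-≤-by-relation Reduces (MIMs-unique W) total (λ {U} {U′} {t} → injective {U} {U′} {t}) ⟩
      length targets    ≡⟨ length-++ (map inj₁ (MIMs (W ∖⁅ v ⁆))) ⟩
      _                 ≡⟨ cong₂ _+_ (length-map inj₁ (MIMs (W ∖⁅ v ⁆)))
                            (trans (length-map inj₂ (concatMap (λ u → map (u ,_) (MIMs (far W u v))) (nbrs W v)))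
                            (trans (length-concatMap (λ u → map (u ,_) (MIMs (far W u v))) (nbrs W v))
                              (sum-cong (nbrs W v) (λ u → length-map (u ,_) (MIMs (far W u v)))))) ⟩
      #MIM (W ∖⁅ v ⁆) + sum (map (λ u → #MIM (far W u v)) (nbrs W v)) ∎
      where open ℕ.≤-Reasoning

-- Separated sets and clique partitions

pairs : {A : Set} → List A → List (A × A)
pairs [] = []
pairs (x ∷ xs) = map (x ,_) xs ++ pairs xs

length-pairs : {A : Set} (xs : List A) → length (pairs xs) ≡ choose₂ (length xs)
length-pairs [] = refl
length-pairs (x ∷ xs) = trans (length-++ (map (x ,_) xs)) (cong₂ _+_ (length-map (x ,_) xs) (length-pairs xs))

∈-pairs⁻ : {A : Set} {xs : List A} {x y : A} → Unique xs → (x , y) ∈ pairs xs → x ∈ xs × y ∈ xs × x ≢ y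
∈-pairs⁻ {xs = z ∷ zs} u@(_ ∷ uzs) p with ∈-++⁻ (map (z ,_) zs) p
... | inj₂ q with ∈-pairs⁻ uzs q
... | x∈ , y∈ , x≢y = there x∈ , there y∈ , x≢y
∈-pairs⁻ {xs = z ∷ zs} u@(_ ∷ uzs) p | inj₁ q with ∈-map⁻ (z ,_) q
... | _ , y∈ , refl = here refl , there y∈ , λ { refl → unique-head u y∈ }

pairs-unique : {A : Set} {xs : List A} → Unique xs → Unique (pairs xs)
pairs-unique [] = []
pairs-unique {xs = x ∷ xs} u@(_ ∷ uxs) = Unique.++⁺ (Unique.map⁺ (λ { refl → refl }) uxs) (pairs-unique uxs)
  λ (p , q) → case ∈-map⁻ (x ,_) p of λ { (_ , _ , refl) → unique-head u (proj₁ (∈-pairs⁻ uxs q)) }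

module _ {n : ℕ} (G : Graph n) where

  open Matchings G

  record Separated (W S : VSet n) : Set where
    constructor separated
    field
      included : ∀ {x} → x ∊ S → x ∊ W
      closed   : ∀ {a b} → a ∊ S → b ∊ W → Edge G a b → b ∊ S

  Clique : VSet n → Set
  Clique S = ∀ {a b} → a ∊ S → b ∊ S → a ≢ b → Edge G a b

  module _ {W S : VSet n} (sep : Separated W S) where

    open Separated sep

    private
      closed-complement : ∀ {a b} → a ∊ W ∖ S → b ∊ W → Edge G a b → b ∊ W ∖ S
      closed-complement a∈ b∈ ab =
        let a∈W , a∉S = ∖⁻ a∈ in ∖⁺ b∈ λ b∈S → a∉S (closed b∈S a∈W (edge-sym ab))

      Splits : Vec Bool n → Vec Bool n × Vec Bool n → Set
      Splits U (U₁ , U₂) = U₁ ≡ U ∩ᵛ S × U₂ ≡ U ∩ᵛ (W ∖ S)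

      ⊆-from-parts : ∀ {U U′} → IsMIM W U → U ∩ᵛ S ≡ U′ ∩ᵛ S → U ∩ᵛ (W ∖ S) ≡ U′ ∩ᵛ (W ∖ S) →
        ∀ {x} → U ∋ x → U′ ∋ x
      ⊆-from-parts m eq₁ eq₂ {x} Ux with x ∊? S
      ... | yes x∈S = ∩ᵛ-determines eq₁ x∈S Ux
      ... | no x∉S = ∩ᵛ-determines eq₂ (∖⁺ (IsMIM.inside m Ux) x∉S) Ux

    #MIM-separated-≤ : #MIM W ≤ #MIM S * #MIM (W ∖ S)
    #MIM-separated-≤ = ℕ.≤-trans
      (length-≤-by-relation Splits (MIMs-unique W)
        (λ {U} p → let m = ∈-MIMs⁻ p in (U ∩ᵛ S , U ∩ᵛ (W ∖ S))
          , ∈-cartesianProduct⁺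
              (∈-MIMs⁺ (restrict m included λ a∈ Ub → closed a∈ (IsMIM.inside m Ub)))
              (∈-MIMs⁺ (restrict m (proj₁ ∘ ∖⁻) λ a∈ Ub → closed-complement a∈ (IsMIM.inside m Ub)))
          , refl , refl)
        λ { p q (eq₁ , eq₂) (eq₁′ , eq₂′) → ∋-ext
          (⊆-from-parts (∈-MIMs⁻ p) (trans (sym eq₁) eq₁′) (trans (sym eq₂) eq₂′))
          (⊆-from-parts (∈-MIMs⁻ q) (trans (sym eq₁′) eq₁) (trans (sym eq₂′) eq₂)) })
      (ℕ.≤-reflexive (length-cartesianProduct (MIMs S) (MIMs (W ∖ S))))

    private
      -- Every edge of W has both ends on the same side, so each side takes care of its own partners
      -- and blocked edges.
      union-isMIM : ∀ {U₁ U₂} → IsMIM S U₁ → IsMIM (W ∖ S) U₂ → IsMIM W (U₁ ∪ᵛ U₂)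
      union-isMIM {U₁} {U₂} (mim sub₁ reg₁ max₁) (mim sub₂ reg₂ max₂) = mim sub reg max
        where
        sub : ∀ {x} → U₁ ∪ᵛ U₂ ∋ x → x ∊ W
        sub p = [ included ∘ sub₁ , proj₁ ∘ ∖⁻ ∘ sub₂ ]′ (∪ᵛ⁻ p)
        reg : OneRegular (U₁ ∪ᵛ U₂)
        reg x p with ∪ᵛ⁻ p
        ... | inj₁ U₁x with reg₁ x U₁x
        ... | y , U₁y , xy , only = y , ∪ᵛ⁺ (inj₁ U₁y) , xy , λ z q xz →
          [ (λ U₁z → only z U₁z xz)
          , (λ U₂z → contradiction (closed (sub₁ U₁x) (sub q) xz) (proj₂ (∖⁻ (sub₂ U₂z)))) ]′ (∪ᵛ⁻ q)
        reg x p | inj₂ U₂x with reg₂ x U₂x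
        ... | y , U₂y , xy , only = y , ∪ᵛ⁺ (inj₂ U₂y) , xy , λ z q xz →
          [ (λ U₁z → contradiction (sub₁ U₁z) (proj₂ (∖⁻ (closed-complement (sub₂ U₂x) (sub q) xz))))
          , (λ U₂z → only z U₂z xz) ]′ (∪ᵛ⁻ q)
        max : ∀ a b → a ∊ W → b ∊ W → Edge G a b → ∃ λ c → U₁ ∪ᵛ U₂ ∋ c × (Edge G a c ⊎ Edge G b c)
        max a b a∈ b∈ ab with a ∊? S
        ... | yes a∈S with max₁ a b a∈S (closed a∈S b∈ ab) ab
        ... | c , U₁c , near = c , ∪ᵛ⁺ (inj₁ U₁c) , near
        max a b a∈ b∈ ab | no a∉S with max₂ a b (∖⁺ a∈ a∉S) (closed-complement (∖⁺ a∈ a∉S) b∈ ab) ab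
        ... | c , U₂c , near = c , ∪ᵛ⁺ (inj₂ U₂c) , near

      left-⊆ : ∀ {U₁ U₂ U₁′ U₂′} → IsMIM S U₁ → IsMIM (W ∖ S) U₂′ → U₁ ∪ᵛ U₂ ≡ U₁′ ∪ᵛ U₂′ → ∀ {x} → U₁ ∋ x → U₁′ ∋ x
      left-⊆ m₁ m₂′ eq {x} U₁x with ∪ᵛ⁻ (subst (_∋ x) eq (∪ᵛ⁺ (inj₁ U₁x)))
      ... | inj₁ p = p
      ... | inj₂ p = contradiction (IsMIM.inside m₁ U₁x) (proj₂ (∖⁻ (IsMIM.inside m₂′ p)))

      right-⊆ : ∀ {U₁ U₂ U₁′ U₂′} → IsMIM (W ∖ S) U₂ → IsMIM S U₁′ → U₁ ∪ᵛ U₂ ≡ U₁′ ∪ᵛ U₂′ → ∀ {x} → U₂ ∋ x → U₂′ ∋ x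
      right-⊆ m₂ m₁′ eq {x} U₂x with ∪ᵛ⁻ (subst (_∋ x) eq (∪ᵛ⁺ (inj₂ U₂x)))
      ... | inj₁ p = contradiction (IsMIM.inside m₁′ p) (proj₂ (∖⁻ (IsMIM.inside m₂ U₂x)))
      ... | inj₂ p = p

    #MIM-separated-≥ : #MIM S * #MIM (W ∖ S) ≤ #MIM W
    #MIM-separated-≥ = ℕ.≤-trans (ℕ.≤-reflexive (sym (length-cartesianProduct (MIMs S) (MIMs (W ∖ S)))))
      (length-≤-by-relation (λ (U₁ , U₂) U → U ≡ U₁ ∪ᵛ U₂) (Unique.cartesianProduct⁺ (MIMs-unique S) (MIMs-unique (W ∖ S)))
        (λ p → let m₁ , m₂ = parts p in _ , ∈-MIMs⁺ (union-isMIM m₁ m₂) , refl)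
        λ p q eq eq′ → let m₁ , m₂ = parts p; m₁′ , m₂′ = parts q; e = trans (sym eq) eq′; e′ = trans (sym eq′) eq in
          cong₂ _,_ (∋-ext (left-⊆ m₁ m₂′ e) (left-⊆ m₁′ m₂ e′)) (∋-ext (right-⊆ m₂ m₁′ e) (right-⊆ m₂′ m₁ e′)))
      where
      parts : ∀ {U₁ U₂} → (U₁ , U₂) ∈ cartesianProduct (MIMs S) (MIMs (W ∖ S)) → IsMIM S U₁ × IsMIM (W ∖ S) U₂
      parts p = let p₁ , p₂ = ∈-cartesianProduct⁻ (MIMs S) (MIMs (W ∖ S)) p in ∈-MIMs⁻ p₁ , ∈-MIMs⁻ p₂

  #MIM-empty-≤ : ∀ {W} → (∀ {x} → ¬ x ∊ W) → #MIM W ≤ 1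
  #MIM-empty-≤ {W} empty = length-≤-by-relation (λ _ _ → ⊤) {ys = tt ∷ []} (MIMs-unique W)
    (λ _ → tt , here refl , tt)
    λ p q _ _ → ∋-ext (λ Ux → contradiction (IsMIM.inside (∈-MIMs⁻ p) Ux) empty)
                      (λ Ux → contradiction (IsMIM.inside (∈-MIMs⁻ q) Ux) empty)

  #MIM-empty-≥ : ∀ {W} → (∀ {x} → ¬ x ∊ W) → 1 ≤ #MIM W
  #MIM-empty-≥ {W} empty = length-≤-by-⊆ {xs = ∅ ∷ []} {ys = MIMs W} (All.[] ∷ [])
    λ { (here refl) → ∈-MIMs⁺ (mim (⊥-elim ∘ no-member) (λ _ → ⊥-elim ∘ no-member) λ _ _ a∈ → contradiction a∈ empty) }
    where
    nothing? : Decidable (λ (_ : Fin n) → ⊥)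
    nothing? _ = no λ ()
    ∅ = [ nothing? ]ᵛ
    no-member : ∀ {x} → ¬ ∅ ∋ x
    no-member = ∋-comprehension⁻ nothing?

  private
    pair? : (p : Fin n × Fin n) → Decidable (λ x → x ≡ proj₁ p ⊎ x ≡ proj₂ p)
    pair? (a , b) x = (x ≟ a) ⊎-dec (x ≟ b)

    ⁅_⁆₂ : Fin n × Fin n → Vec Bool n
    ⁅ p ⁆₂ = [ pair? p ]ᵛ

    -- All vertices of a clique other than a are adjacent to a, and a is adjacent to b, so a single
    -- edge already blocks every edge.
    ⁅⁆₂-isMIM : ∀ {S a b} → Clique S → a ∊ S → b ∊ S → a ≢ b → IsMIM S ⁅ a , b ⁆₂
    ⁅⁆₂-isMIM {S} {a} {b} clique a∈ b∈ a≢b = mim sub reg max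
      where
      left : ⁅ a , b ⁆₂ ∋ a
      left = ∋-comprehension⁺ (pair? (a , b)) (inj₁ refl)
      right : ⁅ a , b ⁆₂ ∋ b
      right = ∋-comprehension⁺ (pair? (a , b)) (inj₂ refl)
      sub : ∀ {x} → ⁅ a , b ⁆₂ ∋ x → x ∊ S
      sub p with ∋-comprehension⁻ (pair? (a , b)) p
      ... | inj₁ refl = a∈
      ... | inj₂ refl = b∈
      reg : OneRegular ⁅ a , b ⁆₂
      reg x p with ∋-comprehension⁻ (pair? (a , b)) p
      ... | inj₁ refl = b , right , clique a∈ b∈ a≢b , λ z q az →
        [ (λ { refl → contradiction az edge-irrefl }) , id ]′ (∋-comprehension⁻ (pair? (a , b)) q)
      ... | inj₂ refl = a , left , clique b∈ a∈ (a≢b ∘ sym) , λ z q bz →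
        [ id , (λ { refl → contradiction bz edge-irrefl }) ]′ (∋-comprehension⁻ (pair? (a , b)) q)
      max : ∀ x y → x ∊ S → y ∊ S → Edge G x y → ∃ λ c → ⁅ a , b ⁆₂ ∋ c × (Edge G x c ⊎ Edge G y c)
      max x y x∈ y∈ xy with x ≟ a
      ... | yes refl = b , right , inj₁ (clique a∈ b∈ a≢b)
      ... | no x≢a = a , left , inj₁ (clique x∈ a∈ x≢a)

    ⁅⁆₂-injective : ∀ {xs} → Unique xs → ∀ {p q} → p ∈ pairs xs → q ∈ pairs xs → ⁅ p ⁆₂ ≡ ⁅ q ⁆₂ → p ≡ q
    ⁅⁆₂-injective {x ∷ xs} u@(_ ∷ uxs) {p} {q} p∈ q∈ eq with ∈-++⁻ (map (x ,_) xs) p∈ | ∈-++⁻ (map (x ,_) xs) q∈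
    ... | inj₂ p∈′ | inj₂ q∈′ = ⁅⁆₂-injective uxs p∈′ q∈′ eq
    ... | inj₁ p∈′ | inj₁ q∈′ with ∈-map⁻ (x ,_) p∈′ | ∈-map⁻ (x ,_) q∈′
    ... | b , b∈ , refl | d , d∈ , refl
      with ∋-comprehension⁻ (pair? (x , d)) (subst (_∋ b) eq (∋-comprehension⁺ (pair? (x , b)) (inj₂ refl)))
    ... | inj₁ refl = contradiction b∈ (unique-head u)
    ... | inj₂ refl = refl
    ⁅⁆₂-injective {x ∷ xs} u@(_ ∷ uxs) {p} {c , d} p∈ q∈ eq | inj₁ p∈′ | inj₂ q∈′ with ∈-map⁻ (x ,_) p∈′
    ... | b , b∈ , refl
      with ∈-pairs⁻ uxs q∈′ | ∋-comprehension⁻ (pair? (c , d)) (subst (_∋ x) eq (∋-comprehension⁺ (pair? (x , b)) (inj₁ refl)))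
    ... | c∈ , _ , _ | inj₁ refl = contradiction c∈ (unique-head u)
    ... | _ , d∈ , _ | inj₂ refl = contradiction d∈ (unique-head u)
    ⁅⁆₂-injective {x ∷ xs} u@(_ ∷ uxs) {c , d} {q} p∈ q∈ eq | inj₂ p∈′ | inj₁ q∈′ with ∈-map⁻ (x ,_) q∈′
    ... | b , b∈ , refl
      with ∈-pairs⁻ uxs p∈′ | ∋-comprehension⁻ (pair? (c , d)) (subst (_∋ x) (sym eq) (∋-comprehension⁺ (pair? (x , b)) (inj₁ refl)))
    ... | c∈ , _ , _ | inj₁ refl = contradiction c∈ (unique-head u)
    ... | _ , d∈ , _ | inj₂ refl = contradiction d∈ (unique-head u)

  #MIM-clique-≥ : ∀ {S} → Clique S → choose₂ (card S) ≤ #MIM S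
  #MIM-clique-≥ {S} clique = ℕ.≤-trans (ℕ.≤-reflexive (sym (length-pairs (elems S))))
    (length-≤-by-relation (λ p U → U ≡ ⁅ p ⁆₂) (pairs-unique (elems-unique S))
      (λ {p} p∈ → let a∈ , b∈ , a≢b = ∈-pairs⁻ (elems-unique S) p∈ in
        ⁅ p ⁆₂ , ∈-MIMs⁺ (⁅⁆₂-isMIM clique (∈-elems⁻ a∈) (∈-elems⁻ b∈) a≢b) , refl)
      λ p∈ q∈ eq eq′ → ⁅⁆₂-injective (elems-unique S) p∈ q∈ (trans (sym eq) eq′))

  -- Cliques are peeled off one at a time, each a union of components of what is left. The orders
  -- are thus recorded in peeling order, which `partition-↭` shows to be immaterial.
  data CliquePartition : VSet n → List ℕ → Set where
    empty : ∀ {W} → (∀ {x} → ¬ x ∊ W) → CliquePartition W []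
    part  : ∀ {W ls} S → Separated W S → Clique S → CliquePartition (W ∖ S) ls → CliquePartition W (card S ∷ ls)

  #MIM-partition-≥ : ∀ {W ls} → CliquePartition W ls → product (map choose₂ ls) ≤ #MIM W
  #MIM-partition-≥ (empty none) = #MIM-empty-≥ none
  #MIM-partition-≥ (part S sep clique rest) =
    ℕ.≤-trans (ℕ.*-mono-≤ (#MIM-clique-≥ clique) (#MIM-partition-≥ rest)) (#MIM-separated-≥ sep)

  -- Peeling two cliques in either order leaves sets with the same members that are not
  -- definitionally equal.
  partition-resp : ∀ {W W′ ls} → (∀ {x} → x ∊ W → x ∊ W′) → (∀ {x} → x ∊ W′ → x ∊ W) →
    CliquePartition W ls → CliquePartition W′ ls
  partition-resp f g (empty none) = empty (none ∘ g)
  partition-resp f g (part S (separated inc closed) clique rest) =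
    part S (separated (f ∘ inc) (λ a∈ b∈ → closed a∈ (g b∈))) clique
      (partition-resp (λ p → let q , r = ∖⁻ p in ∖⁺ (f q) r) (λ p → let q , r = ∖⁻ p in ∖⁺ (g q) r) rest)

  partition-↭ : ∀ {W ls ls′} → ls ↭ ls′ → CliquePartition W ls → CliquePartition W ls′
  partition-↭ ↭.refl P = P
  partition-↭ (↭.prep _ σ) (part S sep clique rest) = part S sep clique (partition-↭ σ rest)
  partition-↭ (↭.trans σ τ) P = partition-↭ τ (partition-↭ σ P)
  partition-↭ {W} (↭.swap _ _ σ) (part S (separated inc closed) clique (part S′ (separated inc′ closed′) clique′ rest)) =
    part S′ (separated (proj₁ ∘ ∖⁻ ∘ inc′) closed″) clique′
      (part S (separated (λ a∈ → ∖⁺ (inc a∈) λ a∈S′ → proj₂ (∖⁻ (inc′ a∈S′)) a∈) (λ a∈ b∈ → closed a∈ (proj₁ (∖⁻ b∈)))) clique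
        (partition-↭ σ (partition-resp exchange exchange rest)))
    where
    exchange : ∀ {X Y x} → x ∊ (W ∖ X) ∖ Y → x ∊ (W ∖ Y) ∖ X
    exchange p = let q , x∉Y = ∖⁻ p; x∈W , x∉X = ∖⁻ q in ∖⁺ (∖⁺ x∈W x∉Y) x∉X
    -- An edge from S′ into S would, as S is closed in W, put its end in S′ into S, although S′ lies
    -- outside S.
    closed″ : ∀ {a b} → a ∊ S′ → b ∊ W → Edge G a b → b ∊ S′
    closed″ a∈ b∈ ab = closed′ a∈ (∖⁺ b∈ λ b∈S → proj₂ (∖⁻ (inc′ a∈)) (closed b∈S (proj₁ (∖⁻ (inc′ a∈))) (edge-sym ab))) ab

-- The upper bound

module _ {n : ℕ} (G : Graph n) where

  open Matchings G

  -- The structural half is conditional on equality, so a strict estimate settles both halves at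
  -- once; `Determined` restricts it to orders at which `sizes` is meaningful or equality cannot
  -- occur.
  Optimal : VSet n → Set
  Optimal W = #MIM W ≤ bound (card W) ×
    (#MIM W ≡ bound (card W) → Determined (card W) → CliquePartition G W (sizes (card W)))

  strict⇒optimal : ∀ {W} → #MIM W < bound (card W) → Optimal W
  strict⇒optimal lt = ℕ.<⇒≤ lt , λ eq → contradiction eq (ℕ.<⇒≢ lt)

  private
    nearIn? : ∀ X v → Decidable (λ x → x ∊ X × Near v x)
    nearIn? X v x = (x ∊? X) ×-dec near? v x

  abstract

    nearIn : VSet n → Fin n → VSet n
    nearIn X v = [ nearIn? X v ]ˢ

    nearIn⁺ : ∀ {X v x} → x ∊ X → Near v x → x ∊ nearIn X v
    nearIn⁺ {X} {v} p q = ∊-comprehension⁺ (nearIn? X v) (p , q)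

    nearIn⁻ : ∀ {X v x} → x ∊ nearIn X v → x ∊ X × Near v x
    nearIn⁻ {X} {v} = ∊-comprehension⁻ (nearIn? X v)

  nbhd : VSet n → Fin n → List (Fin n)
  nbhd X v = v ∷ nbrs X v

  nbhd-unique : ∀ X v → Unique (nbhd X v)
  nbhd-unique X v = unique-∷ (λ p → edge-irrefl (proj₂ (∈-nbrs⁻ p))) (nbrs-unique X v)

  ∈-nbhd⁻ : ∀ {X v x} → v ∊ X → x ∈ nbhd X v → x ∊ X × Near v x
  ∈-nbhd⁻ v∈ (here refl) = v∈ , inj₁ refl
  ∈-nbhd⁻ v∈ (there p) = let x∈ , vx = ∈-nbrs⁻ p in x∈ , inj₂ vx

  ∈-nbhd⁺ : ∀ {X v x} → x ∊ X → Near v x → x ∈ nbhd X v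
  ∈-nbhd⁺ x∈ (inj₁ refl) = here refl
  ∈-nbhd⁺ x∈ (inj₂ vx) = there (∈-nbrs⁺ x∈ vx)

  deg<card : ∀ {X v} → v ∊ X → deg X v < card X
  deg<card {X} {v} v∈ = length-≤-by-⊆ {ys = elems X} (nbhd-unique X v) (λ p → ∈-elems⁺ (proj₁ (∈-nbhd⁻ v∈ p)))

  deg-mono : ∀ {X Y v} → (∀ {x} → x ∊ X → x ∊ Y) → deg X v ≤ deg Y v
  deg-mono {X} {Y} {v} X⊆Y = length-≤-by-⊆ {ys = nbrs Y v} (nbrs-unique X v) λ p → let x∈ , e = ∈-nbrs⁻ p in ∈-nbrs⁺ (X⊆Y x∈) e

  card-∖⁅⁆ : ∀ {X : VSet n} {v} → v ∊ X → card (X ∖⁅ v ⁆) < card X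
  card-∖⁅⁆ {X} {v} v∈ = card-drop {X = X ∖⁅ v ⁆} {ys = v ∷ []} (proj₁ ∘ ∖⁅⁆⁻) (All.[] ∷ [])
    λ { (here refl) → v∈ , λ p → proj₂ (∖⁅⁆⁻ p) refl }

  card-empty : ∀ {X : VSet n} → (∀ {x} → ¬ x ∊ X) → card X ≡ 0
  card-empty {X} none = ℕ.n≤0⇒n≡0 (length-≤-by-⊆ {ys = []} (elems-unique X) (λ p → contradiction (∈-elems⁻ p) none))

  -- For branching at an open neighbour x of v: the partner v removes all of N[v] and gets the
  -- separate bound b.
  branch-except : ∀ {X x v a b} → v ∈ nbrs X x → #MIM (far X v x) ≤ b →
    (∀ {w} → w ∈ nbrs X x → #MIM (far X w x) ≤ a) → #MIM X ≤ #MIM (X ∖⁅ x ⁆) + (b + (deg X x ∸ 1) * a)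
  branch-except {X} {x} v∈ ≤b ≤a = ℕ.≤-trans (branch X x)
    (ℕ.+-monoʳ-≤ (#MIM (X ∖⁅ x ⁆)) (sum-map-≤-except (λ w → #MIM (far X w x)) (nbrs X x) v∈ ≤b ≤a))

  module Step (W : VSet n) (ih : ∀ X → card X < card W → Optimal X) where

    private
      N = card W

    ih-≤ : ∀ {X k} → card X < N → card X ≤ k → #MIM X ≤ bound k
    ih-≤ {X} lt le = ℕ.≤-trans (proj₁ (ih X lt)) (bound-mono le)

    ih-drop : ∀ {X} k → suc k + card X ≤ N → #MIM X ≤ bound (N ∸ suc k)
    ih-drop {X} k le = ih-≤ (ℕ.≤-trans (s≤s (ℕ.m≤n+m (card X) k)) le)
      (ℕ.m+n≤o⇒m≤o∸n (card X) (subst (_≤ N) (ℕ.+-comm (suc k) (card X)) le))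

    ih-outside : ∀ {X y ys} → (∀ {x} → x ∊ X → x ∊ W) → Unique (y ∷ ys) →
      (∀ {z} → z ∈ y ∷ ys → z ∊ W × ¬ z ∊ X) → #MIM X ≤ bound (N ∸ suc (length ys))
    ih-outside {ys = ys} X⊆W u out = ih-drop (length ys) (card-drop X⊆W u out)

    ih-delete : ∀ {v} → v ∊ W → #MIM (W ∖⁅ v ⁆) ≤ bound (N ∸ 1)
    ih-delete v∈ = ih-drop 0 (card-∖⁅⁆ v∈)

    ih-far : ∀ {u v} → v ∊ W → #MIM (far W u v) ≤ bound (N ∸ suc (deg W v))
    ih-far {v = v} v∈ = ih-outside (proj₁ ∘ far⁻) (nbhd-unique W v)
      λ p → let z∈ , near = ∈-nbhd⁻ v∈ p in z∈ , λ q → proj₂ (proj₂ (far⁻ q)) near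

    module AtMaximum (v : Fin n) (v∈ : v ∊ W) (deg-max : ∀ {w} → w ∊ W → deg W w ≤ deg W v) where

      private
        d = deg W v

      d<N : d < N
      d<N = deg<card v∈

      Open : Fin n → Set
      Open u = ∃ λ x → x ∊ W × Edge G u x × ¬ Near v x

      open? : Decidable Open
      open? u = Fin.any? λ x → (x ∊? W) ×-dec edge? u x ×-dec ¬? (near? v x)

      opens : List (Fin n)
      opens = filter open? (nbrs W v)

      opens-⊆ : ∀ {u} → u ∈ opens → u ∊ W × Edge G v u × Open u
      opens-⊆ p = let q , o = ∈-filter⁻ open? {xs = nbrs W v} p; u∈ , vu = ∈-nbrs⁻ q in u∈ , vu , o

      private
        outside-unique : ∀ {x} → ¬ Near v x → Unique (x ∷ nbhd W v)
        outside-unique ¬near = unique-∷ (λ p → ¬near (proj₂ (∈-nbhd⁻ v∈ p))) (nbhd-unique W v)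

      -- Besides N[v], the neighbour of u that makes u open is missing too, so at least d + 2
      -- vertices are lost.
      ih-far-open : ∀ {u} → Open u → #MIM (far W u v) ≤ bound (N ∸ (2 + d))
      ih-far-open (x , x∈ , ux , ¬near) = ih-outside (proj₁ ∘ far⁻) (outside-unique ¬near) λ
        { (here refl) → x∈ , λ q → proj₁ (proj₂ (far⁻ q)) (inj₂ ux)
        ; (there p) → let z∈ , near = ∈-nbhd⁻ v∈ p in z∈ , λ q → proj₂ (proj₂ (far⁻ q)) near }

      ih-far-maximum : ∀ {X u} → (∀ {x} → x ∊ X → x ∊ W) → Open u → #MIM (far X v u) ≤ bound (N ∸ (2 + d))
      ih-far-maximum X⊆W (x , x∈ , ux , ¬near) = ih-outside (X⊆W ∘ proj₁ ∘ far⁻) (outside-unique ¬near) λ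
        { (here refl) → x∈ , λ q → proj₂ (proj₂ (far⁻ q)) (inj₂ ux)
        ; (there p) → let z∈ , near = ∈-nbhd⁻ v∈ p in z∈ , λ q → proj₁ (proj₂ (far⁻ q)) near }

      branch-at-maximum : ∀ k r → k ≤ length opens → d ≡ k + r →
        #MIM W ≤ bound (N ∸ 1) + (k * bound (N ∸ (2 + d)) + r * bound (N ∸ (1 + d)))
      branch-at-maximum k r k≤ eq = ℕ.≤-trans (branch W v) (ℕ.+-mono-≤ (ih-delete v∈)
        (sum-map-≤-split (λ u → #MIM (far W u v)) open? k r (nbrs W v)
          (λ _ → ih-far v∈) (λ _ → ih-far-open) k≤ eq))

      -- X arises by deleting vertices `ds` of N[v] after which no edge leads from N[v] to the rest.
      -- What is left of N[v] has order at most d + 1 - |ds| and splits off as a factor. That `ds`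
      -- is nonempty makes this part smaller than W, so the induction hypothesis applies to it.
      cut : ∀ {X ds} → (∀ {x} → x ∊ X → x ∊ W) →
        (∀ {a b} → a ∊ X → Near v a → b ∊ W → Edge G a b → Near v b) →
        Unique ds → 1 ≤ length ds → (∀ {y} → y ∈ ds → y ∊ W × Near v y × ¬ y ∊ X) →
        #MIM X ≤ bound (suc d ∸ length ds) * bound (N ∸ suc d)
      cut {X} {ds} X⊆W closed uds 1≤ ds-out = ℕ.≤-trans (#MIM-separated-≤ G sep) (ℕ.*-mono-≤
          (ih-≤ (ℕ.≤-trans (ℕ.+-monoˡ-≤ (card S) 1≤) (ℕ.≤-trans size d<N))
                (ℕ.m+n≤o⇒m≤o∸n (card S) (subst (_≤ suc d) (ℕ.+-comm (length ds) (card S)) size)))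
          (ih-outside (X⊆W ∘ proj₁ ∘ ∖⁻) (nbhd-unique W v) λ p → let z∈ , near = ∈-nbhd⁻ v∈ p in
            z∈ , λ q → proj₂ (∖⁻ q) (nearIn⁺ (proj₁ (∖⁻ q)) near)))
        where
        S = nearIn X v
        sep : Separated G X S
        sep = separated (proj₁ ∘ nearIn⁻) λ a∈ b∈ ab →
          nearIn⁺ b∈ (closed (proj₁ (nearIn⁻ a∈)) (proj₂ (nearIn⁻ a∈)) (X⊆W b∈) ab)
        size : length ds + card S ≤ suc d
        size = ℕ.≤-trans (ℕ.≤-reflexive (sym (length-++ ds))) (length-≤-by-⊆ {ys = nbhd W v}
          (Unique.++⁺ uds (elems-unique S) λ (p , q) → proj₂ (proj₂ (ds-out p)) (proj₁ (nearIn⁻ (∈-elems⁻ q))))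
          λ p → [ (λ q → let z∈ , near , _ = ds-out q in ∈-nbhd⁺ z∈ near)
                , (λ q → let z∈ , near = nearIn⁻ (∈-elems⁻ q) in ∈-nbhd⁺ (X⊆W z∈) near) ]′ (∈-++⁻ ds p))

      closed-unless-open : ∀ {a b} → a ∊ W → Near v a → (a ∈ opens → ⊥) → b ∊ W → Edge G a b → Near v b
      closed-unless-open {a} {b} a∈ (inj₁ refl) _ b∈ ab = inj₂ ab
      closed-unless-open {a} {b} a∈ (inj₂ va) ¬open b∈ ab with near? v b
      ... | yes near = near
      ... | no ¬near = contradiction (∈-filter⁺ open? (∈-nbrs⁺ a∈ va) (b , b∈ , ab , ¬near)) ¬open

      2≤deg-open : ∀ {X u x} → v ∊ X → x ∊ X → Edge G v u → Edge G u x → ¬ Near v x → 2 ≤ deg X u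
      2≤deg-open {X} {u} {x} v∈X x∈X vu ux ¬near = length-≤-by-⊆ {xs = v ∷ x ∷ []} {ys = nbrs X u}
        (unique-∷ (λ { (here refl) → ¬near (inj₁ refl) }) (All.[] ∷ []))
        λ { (here refl) → ∈-nbrs⁺ v∈X (edge-sym vu) ; (there (here refl)) → ∈-nbrs⁺ x∈X ux }

      2+d≤N : ∀ {u} → Open u → 2 + d ≤ N
      2+d≤N (x , x∈ , _ , ¬near) = length-≤-by-⊆ {ys = elems W} (outside-unique ¬near)
        λ { (here refl) → ∈-elems⁺ x∈ ; (there p) → ∈-elems⁺ (proj₁ (∈-nbhd⁻ v∈ p)) }

      -- Branching is done at u, not at v: without u the rest of N[v] is cut off. With partner v,
      -- both N[v] and an outside neighbour of u are lost; with any other partner, N[u] is lost.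
      one-open : ∀ {u} → opens ≡ u ∷ [] → ∃ λ j → 2 ≤ j × j ≤ d × 2 + d ≤ N ×
        #MIM W ≤ bound d * bound (N ∸ suc d) + (bound (N ∸ (2 + d)) + (j ∸ 1) * bound (N ∸ suc j))
      one-open {u} eq with opens-⊆ (subst (u ∈_) (sym eq) (here refl))
      ... | u∈ , vu , o@(x , x∈ , ux , ¬near) =
        deg W u , 2≤deg-open v∈ x∈ vu ux ¬near , deg-max u∈ , 2+d≤N o ,
        ℕ.≤-trans (branch-except (∈-nbrs⁺ v∈ (edge-sym vu)) (ih-far-maximum id o) (λ _ → ih-far u∈))
          (ℕ.+-monoˡ-≤ _ (cut {ds = u ∷ []} (proj₁ ∘ ∖⁅⁆⁻) closed (All.[] ∷ []) (s≤s z≤n)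
            λ { (here refl) → u∈ , inj₂ vu , λ p → proj₂ (∖⁅⁆⁻ p) refl }))
        where
        closed : ∀ {a b} → a ∊ W ∖⁅ u ⁆ → Near v a → b ∊ W → Edge G a b → Near v b
        closed a∈ near = closed-unless-open (proj₁ (∖⁅⁆⁻ a∈)) near
          λ p → case subst (_ ∈_) eq p of λ { (here refl) → proj₂ (∖⁅⁆⁻ a∈) refl }

      -- The branching at u is followed by one at u′ in W - u; only after both deletions is the rest
      -- of N[v] cut off.
      two-open : ∀ {u u′} → opens ≡ u ∷ u′ ∷ [] → ∃ λ j → ∃ λ j′ → 2 ≤ j × j ≤ d × 2 ≤ j′ × j′ ≤ d × 2 + d ≤ N ×
        #MIM W ≤ bound (d ∸ 1) * bound (N ∸ suc d) + (bound (N ∸ (2 + d)) + (j′ ∸ 1) * bound (N ∸ (2 + j′)))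
                 + (bound (N ∸ (2 + d)) + (j ∸ 1) * bound (N ∸ suc j))
      two-open {u} {u′} eq
        with opens-⊆ (subst (u ∈_) (sym eq) (here refl)) | opens-⊆ (subst (u′ ∈_) (sym eq) (there (here refl)))
           | subst Unique eq (Unique.filter⁺ open? (nbrs-unique W v))
      ... | u∈ , vu , o@(x , x∈ , ux , ¬near) | u′∈ , vu′ , o′@(x′ , x′∈ , u′x′ , ¬near′) | (u≢u′ All.∷ All.[]) ∷ _ =
        deg W u , deg W₁ u′ , 2≤deg-open v∈ x∈ vu ux ¬near , deg-max u∈ ,
        2≤deg-open v∈₁ (∖⁅⁆⁺ x′∈ λ { refl → ¬near′ (inj₂ vu) }) vu′ u′x′ ¬near′ ,
        ℕ.≤-trans (deg-mono (proj₁ ∘ ∖⁅⁆⁻)) (deg-max u′∈) , 2+d≤N o ,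
        ℕ.≤-trans (branch-except (∈-nbrs⁺ v∈ (edge-sym vu)) (ih-far-maximum id o) (λ _ → ih-far u∈))
          (ℕ.+-monoˡ-≤ _ (ℕ.≤-trans (branch-except (∈-nbrs⁺ v∈₁ (edge-sym vu′)) (ih-far-maximum (proj₁ ∘ ∖⁅⁆⁻) o′) far-w′)
            (ℕ.+-monoˡ-≤ _ (cut {ds = u ∷ u′ ∷ []} (proj₁ ∘ ∖⁅⁆⁻ ∘ proj₁ ∘ ∖⁅⁆⁻) closed
              (unique-∷ (λ { (here refl) → u≢u′ refl }) (All.[] ∷ [])) (s≤s z≤n)
              λ { (here refl) → u∈ , inj₂ vu , λ p → proj₂ (∖⁅⁆⁻ (proj₁ (∖⁅⁆⁻ p))) refl
                ; (there (here refl)) → u′∈ , inj₂ vu′ , λ p → proj₂ (∖⁅⁆⁻ p) refl }))))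
        where
        W₁ = W ∖⁅ u ⁆
        v∈₁ : v ∊ W₁
        v∈₁ = ∖⁅⁆⁺ v∈ λ { refl → edge-irrefl vu }
        u′∈₁ : u′ ∊ W₁
        u′∈₁ = ∖⁅⁆⁺ u′∈ (u≢u′ ∘ sym)
        closed : ∀ {a b} → a ∊ W₁ ∖⁅ u′ ⁆ → Near v a → b ∊ W → Edge G a b → Near v b
        closed a∈ near = closed-unless-open (proj₁ (∖⁅⁆⁻ (proj₁ (∖⁅⁆⁻ a∈)))) near
          λ p → case subst (_ ∈_) eq p of λ { (here refl) → proj₂ (∖⁅⁆⁻ (proj₁ (∖⁅⁆⁻ a∈))) refl
                                            ; (there (here refl)) → proj₂ (∖⁅⁆⁻ a∈) refl }
        far-w′ : ∀ {w} → w ∈ nbrs W₁ u′ → #MIM (far W₁ w u′) ≤ bound (N ∸ (2 + deg W₁ u′))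
        -- The deleted vertex u counts in addition to the closed neighbourhood of u′ in W - u, hence
        -- 2 + `deg W₁ u′`.
        far-w′ _ = ih-outside (proj₁ ∘ ∖⁅⁆⁻ ∘ proj₁ ∘ far⁻)
          (unique-∷ {x = u} (λ p → proj₂ (∖⁅⁆⁻ (proj₁ (∈-nbhd⁻ u′∈₁ p))) refl) (nbhd-unique W₁ u′)) λ
          { (here refl) → u∈ , λ q → proj₂ (∖⁅⁆⁻ (proj₁ (far⁻ q))) refl
          ; (there p) → let z∈ , near = ∈-nbhd⁻ u′∈₁ p in proj₁ (∖⁅⁆⁻ z∈) , λ q → proj₂ (proj₂ (far⁻ q)) near }

      module Component (none-open : opens ≡ []) where

        C : VSet n
        C = nearIn W v

        private
          v∈C : v ∊ C
          v∈C = nearIn⁺ v∈ (inj₁ refl)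

        component-separated : Separated G W C
        component-separated = separated (proj₁ ∘ nearIn⁻) λ a∈ b∈ ab → let a∈W , near = nearIn⁻ a∈ in
          nearIn⁺ b∈ (closed-unless-open a∈W near (λ p → case subst (_ ∈_) none-open p of λ ()) b∈ ab)

        card-component : card C ≡ suc d
        card-component = ℕ.≤-antisym
          (length-≤-by-⊆ {ys = nbhd W v} (elems-unique C) λ p → let z∈ , near = nearIn⁻ (∈-elems⁻ p) in ∈-nbhd⁺ z∈ near)
          (length-≤-by-⊆ {ys = elems C} (nbhd-unique W v) λ p → let z∈ , near = ∈-nbhd⁻ v∈ p in ∈-elems⁺ (nearIn⁺ z∈ near))

        N≡ : N ≡ suc d + card (W ∖ C)
        N≡ = trans (card-∖ (proj₁ ∘ nearIn⁻)) (cong (_+ card (W ∖ C)) card-component)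

        rest<N : card (W ∖ C) < N
        rest<N = ℕ.≤-trans (s≤s (ℕ.m≤n+m (card (W ∖ C)) d)) (ℕ.≤-reflexive (sym N≡))

        private
          -- Every vertex of C is v or a neighbour of v, so nothing in C survives the removal of
          -- N[v].
          far-empty : ∀ {u x} → (u ≡ v ⊎ x ≡ v) → #MIM (far C u x) ≤ 1
          far-empty {u} {x} at-v = #MIM-empty-≤ G λ {z} p →
            let z∈ , ¬u , ¬x = far⁻ p; near = proj₂ (nearIn⁻ z∈) in
            [ (λ { refl → ¬u near }) , (λ { refl → ¬x near }) ]′ at-v

          delete-≤ : ∀ {a} → a ∊ C → #MIM (C ∖⁅ a ⁆) ≤ bound d
          delete-≤ {a} a∈ = ih-≤ (ℕ.≤-trans (s≤s small) d<N) small
            where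
            small : card (C ∖⁅ a ⁆) ≤ d
            small = ℕ.≤-pred (ℕ.≤-trans (card-∖⁅⁆ a∈) (ℕ.≤-reflexive card-component))

        -- Branching at v: each of the d partners leaves the empty set and contributes at most 1.
        -- For d = 3, 4, 5 the sum is the number of edges of K_{d+1}.
        #MIM-component : #MIM C ≤ bound d + d
        #MIM-component = ℕ.≤-trans (branch C v) (ℕ.+-mono-≤ (delete-≤ v∈C)
          (ℕ.≤-trans (sum-map-≤ (λ u → #MIM (far C u v)) (nbrs C v) (λ _ → far-empty (inj₂ refl)))
            (ℕ.≤-trans (ℕ.≤-reflexive (ℕ.*-identityʳ (deg C v))) (deg-mono (proj₁ ∘ nearIn⁻)))))

        -- Branching is done at a vertex a that misses some b. It differs from v, which is adjacent
        -- to all of C, so v is among its partners; and its degree in C is less than d.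
        #MIM-non-clique : (∀ j → j < d → NonCliqueGap d j) → ∀ {a b} → a ∊ C → b ∊ C → a ≢ b → ¬ Edge G a b →
          #MIM C < choose₂ (suc d)
        #MIM-non-clique gap {a} {b} a∈ b∈ a≢b ¬ab = ℕ.≤-trans (s≤s (ℕ.≤-trans
          (branch-except (∈-nbrs⁺ v∈C (edge-sym va)) (far-empty (inj₁ refl)) far-w)
          (ℕ.+-monoˡ-≤ _ (delete-≤ a∈)))) (gap (deg C a) j<d)
          where
          va : Edge G v a
          va with proj₂ (nearIn⁻ a∈)
          ... | inj₂ e = e
          ... | inj₁ refl with proj₂ (nearIn⁻ b∈)
          ... | inj₁ refl = contradiction refl a≢b
          ... | inj₂ e = contradiction e ¬ab
          j<d : deg C a < d
          j<d = ℕ.≤-pred (ℕ.≤-trans (length-≤-by-⊆ {xs = b ∷ nbhd C a} {ys = elems C}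
            (unique-∷ (λ p → [ a≢b ∘ sym , ¬ab ]′ (proj₂ (∈-nbhd⁻ a∈ p))) (nbhd-unique C a))
            λ { (here refl) → ∈-elems⁺ b∈ ; (there p) → ∈-elems⁺ (proj₁ (∈-nbhd⁻ a∈ p)) })
            (ℕ.≤-reflexive card-component))
          far-w : ∀ {w} → w ∈ nbrs C a → #MIM (far C w a) ≤ bound (d ∸ deg C a)
          far-w {w} _ = ih-≤ (ℕ.≤-trans (s≤s (ℕ.≤-trans small (ℕ.m∸n≤m d (deg C a)))) d<N) small
            where
            total : suc (deg C a) + card (far C w a) ≤ suc d
            total = ℕ.≤-trans (card-drop {ys = nbhd C a} (proj₁ ∘ far⁻) (nbhd-unique C a) λ p →
              let z∈ , near = ∈-nbhd⁻ a∈ p in z∈ , λ q → proj₂ (proj₂ (far⁻ q)) near) (ℕ.≤-reflexive card-component)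
            small : card (far C w a) ≤ d ∸ deg C a
            small = ℕ.m+n≤o⇒m≤o∸n _ (subst (_≤ d) (ℕ.+-comm (deg C a) _) (ℕ.≤-pred total))

        clique-or-gap : (∃ λ a → ∃ λ b → a ∊ C × b ∊ C × a ≢ b × ¬ Edge G a b) ⊎ Clique G C
        clique-or-gap with Fin.any? (λ a → Fin.any? (λ b → (a ∊? C) ×-dec (b ∊? C) ×-dec ¬? (a ≟ b) ×-dec ¬? (edge? a b)))
        ... | yes gap = inj₁ gap
        ... | no none = inj₂ λ {a} {b} a∈ b∈ a≢b → case edge? a b of λ
          { (yes ab) → ab ; (no ¬ab) → contradiction (a , b , a∈ , b∈ , a≢b , ¬ab) none }

        -- In the tight alternative, equality for W forces C to be a clique and, after cancelling
        -- the positive factor, equality for W - C; the induction hypothesis then supplies the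
        -- remaining cliques.
        optimal-component : bound d + d ≡ choose₂ (suc d) → (∀ j → j < d → NonCliqueGap d j) →
          (∀ m → AddClique (suc d) (choose₂ (suc d)) m) → Optimal W
        optimal-component c≡ gap add with add (card (W ∖ C))
        ... | inj₁ lt = strict⇒optimal (subst (λ k → #MIM W < bound k) (sym N≡) (ℕ.<-≤-trans (s≤s ≤c*bound) lt))
          where
          ≤c*bound : #MIM W ≤ choose₂ (suc d) * bound (card (W ∖ C))
          ≤c*bound = ℕ.≤-trans (#MIM-separated-≤ G component-separated)
            (ℕ.*-mono-≤ (ℕ.≤-trans #MIM-component (ℕ.≤-reflexive c≡)) (proj₁ (ih (W ∖ C) rest<N)))
        ... | inj₂ (le , det , perm) with clique-or-gap
        ... | inj₁ (a , b , a∈ , b∈ , a≢b , ¬ab) = strict⇒optimal (subst (λ k → #MIM W < bound k) (sym N≡) (begin-strict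
            #MIM W                                         ≤⟨ #MIM-separated-≤ G component-separated ⟩
            #MIM C * #MIM (W ∖ C)                          ≤⟨ ℕ.*-monoʳ-≤ (#MIM C) (proj₁ (ih (W ∖ C) rest<N)) ⟩
            #MIM C * bound (card (W ∖ C))                  <⟨ ℕ.*-monoˡ-< (bound (card (W ∖ C))) ⦃ >-nonZero (bound-positive (card (W ∖ C))) ⦄ (#MIM-non-clique gap a∈ b∈ a≢b ¬ab) ⟩
            choose₂ (suc d) * bound (card (W ∖ C))         ≤⟨ le ⟩
            bound (suc d + card (W ∖ C))                   ∎))
          where open ℕ.≤-Reasoning
        ... | inj₂ clique = ℕ.≤-trans ≤c* (ℕ.≤-trans (ℕ.*-monoʳ-≤ c (proj₁ (ih (W ∖ C) rest<N))) le′) , λ eq _ →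
            subst (λ k → CliquePartition G W (sizes k)) (sym N≡) (partition-↭ G perm
              (subst (λ k → CliquePartition G W (k ∷ sizes (card (W ∖ C)))) card-component
                (part C component-separated clique (proj₂ (ih (W ∖ C) rest<N) (rest-tight eq) det))))
          where
          c = choose₂ (suc d)
          ≤c* : #MIM W ≤ c * #MIM (W ∖ C)
          ≤c* = ℕ.≤-trans (#MIM-separated-≤ G component-separated)
            (ℕ.*-monoˡ-≤ (#MIM (W ∖ C)) (ℕ.≤-trans #MIM-component (ℕ.≤-reflexive c≡)))
          le′ : c * bound (card (W ∖ C)) ≤ bound N
          le′ = subst (λ k → c * bound (card (W ∖ C)) ≤ bound k) (sym N≡) le
          rest-tight : #MIM W ≡ bound N → #MIM (W ∖ C) ≡ bound (card (W ∖ C))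
          rest-tight eq = ℕ.≤-antisym (proj₁ (ih (W ∖ C) rest<N))
            (ℕ.*-cancelˡ-≤ c ⦃ c-nonZero ⦄ (ℕ.≤-trans le′ (ℕ.≤-trans (ℕ.≤-reflexive (sym eq)) ≤c*)))
            where
            c-nonZero : NonZero c
            c-nonZero = >-nonZero (ℕ.≤-trans (bound-positive d) (ℕ.≤-trans (ℕ.m≤m+n (bound d) d) (ℕ.≤-reflexive c≡)))

-- Case analysis on the maximum degree

module _ {n : ℕ} (G : Graph n) where

  open Matchings G

  -- For maximum degree at most 2 nothing has to be identified: order 0 is excluded, and from order
  -- 4 on the estimate is strict.
  weak⇒optimal : ∀ {W b} → #MIM W ≤ b → b ≤ bound (card W) → (4 ≤ card W → b < bound (card W)) → 1 ≤ card W → Optimal G W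
  weak⇒optimal ≤b b≤ b< 1≤ = ℕ.≤-trans ≤b b≤ , λ eq → λ
    { (inj₁ ≡0) → contradiction (subst (1 ≤_) ≡0 1≤) λ ()
    ; (inj₂ 4≤) → contradiction eq (ℕ.<⇒≢ (ℕ.≤-<-trans ≤b (b< 4≤))) }

  module _ (W : VSet n) (ih : ∀ X → card X < card W → Optimal G X)
           (v : Fin n) (v∈ : v ∊ W) (deg-max : ∀ {w} → w ∊ W → deg W w ≤ deg W v) where

    open Step G W ih
    open AtMaximum v v∈ deg-max

    private
      d N : ℕ
      d = deg W v
      N = card W

      first-open : ∀ {u us} → opens ≡ u ∷ us → Open u
      first-open {u} eq = proj₂ (proj₂ (opens-⊆ (subst (u ∈_) (sym eq) (here refl))))

      2≤d : ∀ {u us} → opens ≡ u ∷ us → 2 ≤ d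
      2≤d {u} eq with opens-⊆ (subst (u ∈_) (sym eq) (here refl))
      ... | u∈ , vu , x , x∈ , ux , ¬near = ℕ.≤-trans (2≤deg-open v∈ x∈ vu ux ¬near) (deg-max u∈)

      by-one-open : OneOpen d → ∀ {u} → opens ≡ u ∷ [] → Optimal G W
      by-one-open table eq with one-open eq
      ... | j , 2≤j , j≤d , 2+d≤N′ , le = strict⇒optimal G (ℕ.≤-<-trans le (table 2≤j j≤d 2+d≤N′))

      by-two-open : TwoOpen d → ∀ {u u′} → opens ≡ u ∷ u′ ∷ [] → Optimal G W
      by-two-open table eq with two-open eq
      ... | j , j′ , 2≤j , j≤d , 2≤j′ , j′≤d , 2+d≤N′ , le =
        strict⇒optimal G (ℕ.≤-<-trans le (table 2≤j j≤d 2≤j′ j′≤d 2+d≤N′))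

      by-many-open : ∀ k r → d ≡ k + r → ManyOpen d k r → ∀ {u us} → opens ≡ u ∷ us → k ≤ suc (length us) → Optimal G W
      by-many-open k r d≡ table eq k≤ = strict⇒optimal G (ℕ.≤-<-trans
        (branch-at-maximum k r (subst (λ os → k ≤ length os) (sym eq) k≤) d≡) (table (2+d≤N (first-open eq))))

      by-large-degree : ∀ e → d ≡ 6 + e → Optimal G W
      by-large-degree e eq = strict⇒optimal G (ℕ.≤-<-trans (branch-at-maximum 0 d z≤n refl)
        (subst (λ d → d < N → bound (N ∸ 1) + d * bound (N ∸ (1 + d)) < bound N) (sym eq) (large-degree e) d<N))

      isolated : d ≡ 0 → Optimal G W
      isolated eq = finish (ℕ.≤-trans (s≤s z≤n) d<N) (ℕ.≤-trans (branch-at-maximum 0 0 z≤n eq) (ℕ.≤-reflexive (ℕ.+-identityʳ _)))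
        where
        finish : 1 ≤ N → #MIM W ≤ bound (N ∸ 1) → Optimal G W
        finish 1≤N le = weak⇒optimal le (bound-mono (ℕ.m∸n≤m N 1)) strict 1≤N
          where
          strict : 4 ≤ N → bound (N ∸ 1) < bound N
          strict 4≤N with N | ℕ.m≤n⇒∃[o]m+o≡n 4≤N
          ... | _ | m , refl = check-< (shift 3) (shift 4) m

      small-component : (none : opens ≡ []) → ∀ c k → d ≡ k → #MIM (Component.C none) ≤ c →
        (∀ m → c * bound m ≤ bound (suc k + m)) → (∀ m → 4 ≤ suc k + m → c * bound m < bound (suc k + m)) → Optimal G W
      small-component none c k refl C≤c weak strict = weak⇒optimal
        (ℕ.≤-trans (#MIM-separated-≤ G component-separated) (ℕ.*-mono-≤ C≤c (proj₁ (ih (W ∖ C) rest<N))))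
        (subst (λ N → c * bound (card (W ∖ C)) ≤ bound N) (sym N≡) (weak (card (W ∖ C))))
        (subst (λ N → 4 ≤ N → c * bound (card (W ∖ C)) < bound N) (sym N≡) (strict (card (W ∖ C))))
        (ℕ.≤-trans (s≤s z≤n) d<N)
        where open Component none

      -- Branching would only give `bound 1 + 1`, which is 2. Directly: the edge vu must be blocked,
      -- so one of its ends is covered, its partner can only be the other end, and the matching is
      -- the whole component.
      #MIM-edge-component : (none : opens ≡ []) → d ≡ 1 → #MIM (Component.C none) ≤ 1
      #MIM-edge-component none d≡1 with singleton (nbrs W v) d≡1
        where
        singleton : (xs : List (Fin n)) → length xs ≡ 1 → ∃ λ u → xs ≡ u ∷ []
        singleton (u ∷ []) _ = u , refl
      ... | u , nbrs≡ = length-≤-by-relation (λ _ _ → ⊤) {ys = tt ∷ []} (MIMs-unique C) (λ _ → tt , here refl , tt)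
        λ p q _ _ → ∋-ext (full (∈-MIMs⁻ q) ∘ IsMIM.inside (∈-MIMs⁻ p)) (full (∈-MIMs⁻ p) ∘ IsMIM.inside (∈-MIMs⁻ q))
        where
        open Component none
        u∈nbrs : u ∈ nbrs W v
        u∈nbrs = subst (u ∈_) (sym nbrs≡) (here refl)
        vu : Edge G v u
        vu = proj₂ (∈-nbrs⁻ u∈nbrs)
        endpoint : ∀ {x} → x ∊ C → x ≡ v ⊎ x ≡ u
        endpoint x∈ with nearIn⁻ G x∈
        ... | _ , inj₁ eq = inj₁ eq
        ... | x∈W , inj₂ vx = case subst (_ ∈_) nbrs≡ (∈-nbrs⁺ x∈W vx) of λ { (here eq) → inj₂ eq }
        both : ∀ {U} → IsMIM C U → U ∋ v × U ∋ u
        both {U} (mim sub reg max)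
          with max v u (nearIn⁺ G v∈ (inj₁ refl)) (nearIn⁺ G (proj₁ (∈-nbrs⁻ u∈nbrs)) (inj₂ vu)) vu
        ... | c , Uc , _ with endpoint (sub Uc)
        ... | inj₁ c≡v = let Uv = subst (U ∋_) c≡v Uc; y , Uy , vy , _ = reg v Uv in
          Uv , [ (λ y≡v → contradiction (subst (Edge G v) y≡v vy) edge-irrefl) , (λ y≡u → subst (U ∋_) y≡u Uy) ]′ (endpoint (sub Uy))
        ... | inj₂ c≡u = let Uu = subst (U ∋_) c≡u Uc; y , Uy , uy , _ = reg u Uu in
          [ (λ y≡v → subst (U ∋_) y≡v Uy) , (λ y≡u → contradiction (subst (Edge G u) y≡u uy) edge-irrefl) ]′ (endpoint (sub Uy)) , Uu
        full : ∀ {U x} → IsMIM C U → x ∊ C → U ∋ x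
        full m x∈ with endpoint x∈
        ... | inj₁ refl = proj₁ (both m)
        ... | inj₂ refl = proj₂ (both m)

      isolated-edge : opens ≡ [] → d ≡ 1 → Optimal G W
      isolated-edge none d≡1 = small-component none 1 1 d≡1 (#MIM-edge-component none d≡1)
        (check-≤ (1 ⊗ shift 0) (shift 2)) λ { (suc (suc m)) _ → check-< (1 ⊗ shift 2) (shift 4) m
                                            ; zero (s≤s (s≤s ())) ; (suc zero) (s≤s (s≤s (s≤s ()))) }

      isolated-three : opens ≡ [] → d ≡ 2 → Optimal G W
      isolated-three none d≡2 = small-component none 3 2 d≡2
        (subst (λ d → #MIM (Component.C none) ≤ bound d + d) d≡2 (Component.#MIM-component none))
        (check-≤ (3 ⊗ shift 0) (shift 3)) λ { (suc m) _ → check-< (3 ⊗ shift 1) (shift 4) m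
                                            ; zero (s≤s (s≤s (s≤s ()))) }

      isolated-clique : ∀ k → bound k + k ≡ choose₂ (suc k) → (∀ j → j < k → NonCliqueGap k j) →
        (∀ m → AddClique (suc k) (choose₂ (suc k)) m) → d ≡ k → opens ≡ [] → Optimal G W
      isolated-clique k c≡ gap add refl none = Component.optimal-component none c≡ gap add

      -- Branching at v is strict once all neighbours are open for d = 2 or 3, three for d = 4, one
      -- for d = 5, and always for d ≥ 6. Fewer open neighbours, but at least one, are treated by
      -- cutting at them.
      by-cases : ∀ k → d ≡ k → ∀ os → opens ≡ os → Optimal G W
      by-cases 0 eq _ _ = isolated eq
      by-cases 1 eq [] none = isolated-edge none eq
      -- An open neighbour is adjacent to v and to a vertex outside N[v], so its degree would exceed
      -- the maximum degree 1.
      by-cases 1 eq (_ ∷ _) os≡ = contradiction (subst (2 ≤_) eq (2≤d os≡)) λ { (s≤s ()) }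
      by-cases 2 eq [] none = isolated-three none eq
      by-cases 2 eq (_ ∷ []) os≡ = by-one-open (subst OneOpen (sym eq) one-open₂) os≡
      by-cases 2 eq (_ ∷ _ ∷ _) os≡ = by-many-open 2 0 eq (subst (λ d → ManyOpen d 2 0) (sym eq) many-open₂) os≡ (s≤s (s≤s z≤n))
      by-cases 3 eq [] none = isolated-clique 3 refl (non-clique-gap 3) (add-clique 4 6) eq none
      by-cases 3 eq (_ ∷ []) os≡ = by-one-open (subst OneOpen (sym eq) one-open₃) os≡
      by-cases 3 eq (_ ∷ _ ∷ []) os≡ = by-two-open (subst TwoOpen (sym eq) two-open₃) os≡
      by-cases 3 eq (_ ∷ _ ∷ _ ∷ _) os≡ =
        by-many-open 3 0 eq (subst (λ d → ManyOpen d 3 0) (sym eq) many-open₃) os≡ (s≤s (s≤s (s≤s z≤n)))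
      by-cases 4 eq [] none = isolated-clique 4 refl (non-clique-gap 4) (add-clique 5 10) eq none
      by-cases 4 eq (_ ∷ []) os≡ = by-one-open (subst OneOpen (sym eq) one-open₄) os≡
      by-cases 4 eq (_ ∷ _ ∷ []) os≡ = by-two-open (subst TwoOpen (sym eq) two-open₄) os≡
      by-cases 4 eq (_ ∷ _ ∷ _ ∷ _) os≡ =
        by-many-open 3 1 eq (subst (λ d → ManyOpen d 3 1) (sym eq) many-open₄) os≡ (s≤s (s≤s (s≤s z≤n)))
      by-cases 5 eq [] none = isolated-clique 5 refl (non-clique-gap 5) (add-clique 6 15) eq none
      by-cases 5 eq (_ ∷ _) os≡ = by-many-open 1 4 eq (subst (λ d → ManyOpen d 1 4) (sym eq) many-open₅) os≡ (s≤s z≤n)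
      by-cases (suc (suc (suc (suc (suc (suc e)))))) eq _ _ = by-large-degree e eq

    optimal-step : Optimal G W
    optimal-step = by-cases d refl opens refl

  empty-or-maximum : ∀ W → (∀ {x} → ¬ x ∊ W) ⊎ ∃ λ v → v ∊ W × (∀ {w} → w ∊ W → deg W w ≤ deg W v)
  empty-or-maximum W with elems W in elems≡
  ... | [] = inj₁ λ x∈ → case subst (_ ∈_) elems≡ (∈-elems⁺ x∈) of λ ()
  ... | x ∷ xs = let v , v∈ , max = maximiser (deg W) x xs in
    inj₂ (v , ∈-elems⁻ (subst (v ∈_) (sym elems≡) v∈) , λ {w} w∈ → max (subst (w ∈_) elems≡ (∈-elems⁺ w∈)))

  optimal-below : ∀ fuel W → card W < fuel → Optimal G W
  optimal-below (suc fuel) W lt with empty-or-maximum W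
  ... | inj₁ none = ℕ.≤-trans (#MIM-empty-≤ G none) (bound-positive (card W)) ,
    λ _ _ → subst (λ k → CliquePartition G W (sizes k)) (sym (card-empty G none)) (empty none)
  ... | inj₂ (v , v∈ , max) =
    optimal-step W (λ X X<W → optimal-below fuel X (ℕ.<-≤-trans X<W (ℕ.≤-pred lt))) v v∈ max

  optimal : ∀ W → Optimal G W
  optimal W = optimal-below (suc (card W)) W ℕ.≤-refl

-- Clique partitions and isomorphism with clique unions

lookup-injective : {A : Set} {xs : List A} → Unique xs → ∀ i j → List.lookup xs i ≡ List.lookup xs j → i ≡ j
lookup-injective (_ ∷ _) zero zero _ = refl
lookup-injective {xs = x ∷ xs} u zero (suc j) eq = contradiction (subst (_∈ xs) (sym eq) (∈-lookup j)) (unique-head u)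
lookup-injective {xs = x ∷ xs} u (suc i) zero eq = contradiction (subst (_∈ xs) eq (∈-lookup i)) (unique-head u)
lookup-injective (_ ∷ u) (suc i) (suc j) eq = cong suc (lookup-injective u i j eq)

block-⊎ : ∀ {a} ls → Fin a ⊎ Fin (sum ls) → ℕ
block-⊎ ls = [ (λ _ → 0) , (λ j → suc (block ls j)) ]′

block-∷ : ∀ a ls i → block (a ∷ ls) i ≡ block-⊎ ls (splitAt a i)
block-∷ a ls i with splitAt a i
... | inj₁ _ = refl
... | inj₂ _ = refl

block-join : ∀ a ls (s : Fin a ⊎ Fin (sum ls)) → block (a ∷ ls) (join a (sum ls) s) ≡ block-⊎ ls s
block-join a ls s = trans (block-∷ a ls (join a (sum ls) s)) (cong (block-⊎ ls) (Fin.splitAt-join a (sum ls) s))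

splitAt-injective : ∀ a {b} {i j : Fin (a + b)} → splitAt a i ≡ splitAt a j → i ≡ j
splitAt-injective a {b} {i} {j} eq = trans (sym (Fin.join-splitAt a b i)) (trans (cong (join a b) eq) (Fin.join-splitAt a b j))

cliqueAdj⁺ : ∀ ls {i j} → block ls i ≡ block ls j → i ≢ j → T (cliqueAdj ls i j)
cliqueAdj⁺ ls {i} {j} eq i≢j with block ls i ℕ.≟ block ls j | i ≟ j
... | yes _ | no _ = tt
... | no ≢ | _ = ≢ eq
... | yes _ | yes i≡j = i≢j i≡j

cliqueAdj⁻ : ∀ ls {i j} → T (cliqueAdj ls i j) → block ls i ≡ block ls j × i ≢ j
cliqueAdj⁻ ls {i} {j} p with block ls i ℕ.≟ block ls j | i ≟ j
... | yes eq | no i≢j = eq , i≢j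

module _ {n : ℕ} (G : Graph n) where

  open Matchings G

  -- An isomorphism between the graph induced on W and `cliqueUnion ls`, kept inside G so that it
  -- can be built or taken apart one block at a time.
  record Layout (W : VSet n) (ls : List ℕ) : Set where
    field
      place       : Fin (sum ls) → Fin n
      inside      : ∀ i → place i ∊ W
      injective   : ∀ {i j} → place i ≡ place j → i ≡ j
      covers      : ∀ {x} → x ∊ W → ∃ λ i → place i ≡ x
      same-block  : ∀ {i j} → block ls i ≡ block ls j → i ≢ j → Edge G (place i) (place j)
      block-equal : ∀ {i j} → Edge G (place i) (place j) → block ls i ≡ block ls j

  partition⇒layout : ∀ {W ls} → CliquePartition G W ls → Layout W ls
  partition⇒layout (empty none) = record
    { place = λ () ; inside = λ () ; injective = λ { {()} } ; covers = λ x∈ → contradiction x∈ none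
    ; same-block = λ { {()} } ; block-equal = λ { {()} } }
  partition⇒layout {W} (part {ls = ls} S (separated included closed) clique rest) = record
    { place = λ i → place₊ (splitAt a i)
    ; inside = λ i → inside₊ (splitAt a i)
    ; injective = λ eq → splitAt-injective a (injective₊ _ _ eq)
    ; covers = λ x∈ → let s , eq = covers₊ x∈ in
        join a (sum ls) s , trans (cong place₊ (Fin.splitAt-join a (sum ls) s)) eq
    ; same-block = λ {i} {j} eq i≢j → same-block₊ (splitAt a i) (splitAt a j)
        (trans (sym (block-∷ a ls i)) (trans eq (block-∷ a ls j))) (i≢j ∘ splitAt-injective a)
    ; block-equal = λ {i} {j} e →
        trans (block-∷ a ls i) (trans (block-equal₊ (splitAt a i) (splitAt a j) e) (sym (block-∷ a ls j)))
    }
    where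
    module R = Layout (partition⇒layout rest)
    a = card S
    first : Fin a → Fin n
    first = List.lookup (elems S)
    first∈ : ∀ i → first i ∊ S
    first∈ i = ∈-elems⁻ {W = S} (∈-lookup i)
    place₊ : Fin a ⊎ Fin (sum ls) → Fin n
    place₊ = [ first , R.place ]′
    inside₊ : ∀ s → place₊ s ∊ W
    inside₊ (inj₁ i) = included (first∈ i)
    inside₊ (inj₂ j) = proj₁ (∖⁻ (R.inside j))
    injective₊ : ∀ s t → place₊ s ≡ place₊ t → s ≡ t
    injective₊ (inj₁ i) (inj₁ j) eq = cong inj₁ (lookup-injective (elems-unique S) i j eq)
    injective₊ (inj₁ i) (inj₂ j) eq = contradiction (subst (_∊ S) eq (first∈ i)) (proj₂ (∖⁻ (R.inside j)))
    injective₊ (inj₂ i) (inj₁ j) eq = contradiction (subst (_∊ S) (sym eq) (first∈ j)) (proj₂ (∖⁻ (R.inside i)))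
    injective₊ (inj₂ i) (inj₂ j) eq = cong inj₂ (R.injective eq)
    covers₊ : ∀ {x} → x ∊ W → ∃ λ s → place₊ s ≡ x
    covers₊ {x} x∈ with x ∊? S
    ... | yes x∈S = inj₁ (Any.index (∈-elems⁺ x∈S)) , sym (lookup-index (∈-elems⁺ x∈S))
    ... | no x∉S = let j , eq = R.covers (∖⁺ x∈ x∉S) in inj₂ j , eq
    same-block₊ : ∀ s t → block-⊎ ls s ≡ block-⊎ ls t → s ≢ t → Edge G (place₊ s) (place₊ t)
    same-block₊ (inj₁ i) (inj₁ j) _ s≢t = clique (first∈ i) (first∈ j) (s≢t ∘ injective₊ (inj₁ i) (inj₁ j))
    same-block₊ (inj₂ i) (inj₂ j) eq s≢t = R.same-block (ℕ.suc-injective eq) (s≢t ∘ cong inj₂)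
    block-equal₊ : ∀ s t → Edge G (place₊ s) (place₊ t) → block-⊎ ls s ≡ block-⊎ ls t
    block-equal₊ (inj₁ _) (inj₁ _) _ = refl
    block-equal₊ (inj₁ i) (inj₂ j) e =
      contradiction (closed (first∈ i) (proj₁ (∖⁻ (R.inside j))) e) (proj₂ (∖⁻ (R.inside j)))
    block-equal₊ (inj₂ i) (inj₁ j) e =
      contradiction (closed (first∈ j) (proj₁ (∖⁻ (R.inside i))) (edge-sym e)) (proj₂ (∖⁻ (R.inside i)))
    block-equal₊ (inj₂ i) (inj₂ j) e = cong suc (R.block-equal e)

  layout⇒partition : ∀ {W} ls → Layout W ls → CliquePartition G W ls
  layout⇒partition [] L = empty λ x∈ → case Layout.covers L x∈ of λ { (() , _) }
  -- `part` records the order of its clique as `card S`, which has to be identified with the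
  -- prescribed a.
  layout⇒partition {W} (a ∷ ls) L = subst (λ k → CliquePartition G W (k ∷ ls)) card-S
    (part S (separated included closed) clique (layout⇒partition ls rest))
    where
    open Layout L
    place₊ : Fin a ⊎ Fin (sum ls) → Fin n
    place₊ s = place (join a (sum ls) s)
    join-injective : ∀ {s t} → join a (sum ls) s ≡ join a (sum ls) t → s ≡ t
    join-injective {s} {t} eq = trans (sym (Fin.splitAt-join a (sum ls) s))
      (trans (cong (splitAt a) eq) (Fin.splitAt-join a (sum ls) t))
    injective₊ : ∀ {s t} → place₊ s ≡ place₊ t → s ≡ t
    injective₊ = join-injective ∘ injective
    covers₊ : ∀ {x} → x ∊ W → ∃ λ s → place₊ s ≡ x
    covers₊ x∈ = let i , eq = covers x∈ in splitAt a i , trans (cong place (Fin.join-splitAt a (sum ls) i)) eq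
    same-block₊ : ∀ s t → block-⊎ ls s ≡ block-⊎ ls t → s ≢ t → Edge G (place₊ s) (place₊ t)
    same-block₊ s t eq s≢t =
      same-block (trans (block-join a ls s) (trans eq (sym (block-join a ls t)))) (s≢t ∘ join-injective)
    block-equal₊ : ∀ s t → Edge G (place₊ s) (place₊ t) → block-⊎ ls s ≡ block-⊎ ls t
    block-equal₊ s t e = trans (sym (block-join a ls s)) (trans (block-equal e) (block-join a ls t))
    first? : Decidable (λ x → ∃ λ i → place₊ (inj₁ i) ≡ x)
    first? x = Fin.any? λ i → place₊ (inj₁ i) ≟ x
    S : VSet n
    S = [ first? ]ˢ
    S⁺ : ∀ i → place₊ (inj₁ i) ∊ S
    S⁺ i = ∊-comprehension⁺ first? (i , refl)
    S⁻ : ∀ {x} → x ∊ S → ∃ λ i → place₊ (inj₁ i) ≡ x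
    S⁻ = ∊-comprehension⁻ first?
    included : ∀ {x} → x ∊ S → x ∊ W
    included x∈ with S⁻ x∈
    ... | i , refl = inside _
    closed : ∀ {x y} → x ∊ S → y ∊ W → Edge G x y → y ∊ S
    closed x∈ y∈ e with S⁻ x∈ | covers₊ y∈
    ... | i , refl | inj₁ j , refl = S⁺ j
    ... | i , refl | inj₂ j , refl = case block-equal₊ (inj₁ i) (inj₂ j) e of λ ()
    clique : Clique G S
    clique x∈ y∈ x≢y with S⁻ x∈ | S⁻ y∈
    ... | i , refl | j , refl = same-block₊ (inj₁ i) (inj₁ j) refl λ { refl → x≢y refl }
    card-S : card S ≡ a
    card-S = trans
      (ℕ.≤-antisym
        (length-≤-by-relation (λ x i → place₊ (inj₁ i) ≡ x) {ys = allFin a} (elems-unique S)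
          (λ x∈ → let i , eq = S⁻ (∈-elems⁻ x∈) in i , ∈-allFin i , eq) λ { _ _ refl refl → refl })
        (length-≤-by-relation (λ i x → place₊ (inj₁ i) ≡ x) {ys = elems S} (Unique.allFin⁺ a)
          (λ {i} _ → place₊ (inj₁ i) , ∈-elems⁺ (S⁺ i) , refl)
          λ _ _ eq eq′ → inj₁-injective (injective₊ (trans eq (sym eq′)))))
      (length-tabulate id)
    rest : Layout (W ∖ S) ls
    rest = record
      { place = place₊ ∘ inj₂
      ; inside = λ j → ∖⁺ (inside _) λ p → case injective₊ {inj₁ _} {inj₂ j} (proj₂ (S⁻ p)) of λ ()
      ; injective = inj₂-injective ∘ injective₊
      ; covers = λ x∈ → case covers₊ (proj₁ (∖⁻ x∈)) of λ
          { (inj₁ i , refl) → contradiction (S⁺ i) (proj₂ (∖⁻ x∈)) ; (inj₂ j , eq) → j , eq }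
      ; same-block = λ {i} {j} eq i≢j → same-block₊ (inj₂ i) (inj₂ j) (cong suc eq) (i≢j ∘ inj₂-injective)
      ; block-equal = λ {i} {j} e → ℕ.suc-injective (block-equal₊ (inj₂ i) (inj₂ j) e)
      }

  everything : VSet n
  everything _ = true

  layout⇒≅ : ∀ ls → Layout everything ls → G ≅ cliqueUnion ls
  layout⇒≅ ls L = mk↔ₛ′ index place (λ i → injective (place-index (place i))) place-index , λ x y → T-ext
    (λ e → cliqueAdj⁺ ls (block-equal (subst₂ (Edge G) (sym (place-index x)) (sym (place-index y)) e))
      λ eq → edge-irrefl (subst (Edge G x) (trans (sym (place-index y)) (trans (cong place (sym eq)) (place-index x))) e))
    (λ p → let eq , ≢ = cliqueAdj⁻ ls p in subst₂ (Edge G) (place-index x) (place-index y) (same-block eq ≢))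
    where
    open Layout L
    index : Fin n → Fin (sum ls)
    index x = proj₁ (covers {x} (in-set tt))
    place-index : ∀ x → place (index x) ≡ x
    place-index x = proj₂ (covers {x} (in-set tt))

  ≅⇒layout : ∀ ls → G ≅ cliqueUnion ls → Layout everything ls
  ≅⇒layout ls (f , preserves) = record
    { place = from
    ; inside = λ _ → in-set tt
    ; injective = λ {i} {j} eq → trans (sym (strictlyInverseˡ i)) (trans (cong to eq) (strictlyInverseˡ j))
    ; covers = λ {x} _ → to x , strictlyInverseʳ x
    ; same-block = λ {i} {j} eq i≢j → subst T (sym (adj-from i j)) (cliqueAdj⁺ ls eq i≢j)
    ; block-equal = λ {i} {j} e → proj₁ (cliqueAdj⁻ ls (subst T (adj-from i j) e))
    }
    where
    open Inverse f
    adj-from : ∀ i j → adj G (from i) (from j) ≡ cliqueAdj ls i j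
    adj-from i j = trans (preserves (from i) (from j)) (cong₂ (cliqueAdj ls) (strictlyInverseˡ i) (strictlyInverseˡ j))

-- Edge sets and endpoint sets

module _ {n : ℕ} (G : Graph n) where

  open Matchings G

  private
    covered? : (M : EdgeSet n) → Decidable (InV M)
    covered? M v = Fin.any? λ u → T? (lookup (lookup M v) u)

    joined? : (U : Vec Bool n) (i j : Fin n) → Dec (U ∋ i × U ∋ j × Edge G i j)
    joined? U i j = (U ∋? i) ×-dec (U ∋? j) ×-dec edge? i j

  abstract

    endpoints : EdgeSet n → Vec Bool n
    endpoints M = [ covered? M ]ᵛ

    endpoints⁺ : ∀ {M v} → InV M v → endpoints M ∋ v
    endpoints⁺ {M} = ∋-comprehension⁺ (covered? M)

    endpoints⁻ : ∀ {M v} → endpoints M ∋ v → InV M v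
    endpoints⁻ {M} = ∋-comprehension⁻ (covered? M)

    inducedEdges : Vec Bool n → EdgeSet n
    inducedEdges U = tabulate λ i → [ joined? U i ]ᵛ

    inducedEdges⁺ : ∀ {U i j} → U ∋ i → U ∋ j → Edge G i j → (i , j) ∈E inducedEdges U
    inducedEdges⁺ {U} {i} {j} p q e = subst (λ row → T (lookup row j)) (sym (lookup∘tabulate (λ i → [ joined? U i ]ᵛ) i))
      (_∋_.holds (∋-comprehension⁺ (joined? U i) (p , q , e)))

    inducedEdges⁻ : ∀ {U i j} → (i , j) ∈E inducedEdges U → U ∋ i × U ∋ j × Edge G i j
    inducedEdges⁻ {U} {i} {j} p = ∋-comprehension⁻ (joined? U i)
      (in-vec (subst (λ row → T (lookup row j)) (lookup∘tabulate (λ i → [ joined? U i ]ᵛ) i) p))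

  ∈E-ext : ∀ {M M′ : EdgeSet n} → M ⊆E M′ → M′ ⊆E M → M ≡ M′
  ∈E-ext {M} {M′} f g = trans (sym (tabulate∘lookup M)) (trans
    (tabulate-cong λ i → ∋-ext (in-vec ∘ f i _ ∘ _∋_.holds) (in-vec ∘ g i _ ∘ _∋_.holds)) (tabulate∘lookup M′))

  oneRegular⇒inducedMatching : ∀ {U} → OneRegular U → IsInducedMatching G (inducedEdges U)
  oneRegular⇒inducedMatching {U} reg =
    (λ i j p → proj₂ (proj₂ (inducedEdges⁻ p))) ,
    (λ i j → T-ext flip flip) ,
    λ v (u , p) → let Uv , _ = inducedEdges⁻ p; y , Uy , vy , only = reg v Uv in
      (y , (v , inducedEdges⁺ Uy Uv (edge-sym vy)) , vy) ,
      λ a b (_ , pa) va (_ , pb) vb → trans (only a (proj₁ (inducedEdges⁻ pa)) va) (sym (only b (proj₁ (inducedEdges⁻ pb)) vb))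
    where
    flip : ∀ {i j} → (i , j) ∈E inducedEdges U → (j , i) ∈E inducedEdges U
    flip p = let Ui , Uj , e = inducedEdges⁻ p in inducedEdges⁺ Uj Ui (edge-sym e)

  module _ {M : EdgeSet n} (induced : IsInducedMatching G M) where

    private
      edges = proj₁ induced
      symmetric = proj₁ (proj₂ induced)
      regular = proj₂ (proj₂ induced)

    InV-right : ∀ {i j} → (i , j) ∈E M → InV M j
    InV-right {i} {j} p = i , subst T (symmetric i j) p

    endpoints-oneRegular : OneRegular (endpoints M)
    endpoints-oneRegular x p = let (y , y∈ , xy) , only = regular x (endpoints⁻ p) in
      y , endpoints⁺ y∈ , xy , λ z q xz → only z y (endpoints⁻ q) xz y∈ xy

    ⊆-inducedEdges : M ⊆E inducedEdges (endpoints M)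
    ⊆-inducedEdges i j p = inducedEdges⁺ (endpoints⁺ (j , p)) (endpoints⁺ (InV-right p)) (edges i j p)

    -- Two endpoints of M joined in G are joined in M: the second must be the partner of the first,
    -- its only neighbour among the endpoints.
    inducedEdges-endpoints : M ≡ inducedEdges (endpoints M)
    inducedEdges-endpoints = ∈E-ext ⊆-inducedEdges λ i j p →
      let Ui , Uj , ij = inducedEdges⁻ p; u , iu = endpoints⁻ Ui in
      subst (λ k → (i , k) ∈E M)
        (proj₂ (regular i (u , iu)) u j (InV-right iu) (edges i u iu) (endpoints⁻ Uj) ij) iu

  endpoints-inducedEdges : ∀ {U} → OneRegular U → U ≡ endpoints (inducedEdges U)
  endpoints-inducedEdges {U} reg = ∋-ext
    (λ {x} Ux → let y , Uy , xy , _ = reg x Ux in endpoints⁺ (y , inducedEdges⁺ Ux Uy xy))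
    (λ p → proj₁ (inducedEdges⁻ (proj₂ (endpoints⁻ p))))

  maximal⇒isMIM : ∀ {M} → IsMaximalInducedMatching G M → IsMIM (everything G) (endpoints M)
  maximal⇒isMIM {M} (induced , maximal) = mim (λ _ → in-set tt) reg blocked
    where
    U = endpoints M
    reg = endpoints-oneRegular induced
    blocked : ∀ a b → a ∊ everything G → b ∊ everything G → Edge G a b → ∃ λ c → U ∋ c × (Edge G a c ⊎ Edge G b c)
    blocked a b _ _ ab with Fin.any? (λ c → (U ∋? c) ×-dec (edge? a c ⊎-dec edge? b c))
    ... | yes found = found
    -- If nothing blocks ab, then adding a and b to U keeps it 1-regular. Maximality makes the
    -- larger matching equal to M, so b is already an endpoint, and being adjacent to a it blocks ab
    -- after all.
    ... | no none = contradiction (b , endpoints⁺ (a , ba∈M) , inj₁ ab) none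
      where
      extended? : Decidable (λ x → U ∋ x ⊎ x ≡ a ⊎ x ≡ b)
      extended? x = (U ∋? x) ⊎-dec (x ≟ a) ⊎-dec (x ≟ b)
      U⁺ = [ extended? ]ᵛ
      from : ∀ {x} → U ∋ x ⊎ x ≡ a ⊎ x ≡ b → U⁺ ∋ x
      from = ∋-comprehension⁺ extended?
      reg⁺ : OneRegular U⁺
      reg⁺ x p with ∋-comprehension⁻ extended? p
      ... | inj₁ Ux = let y , Uy , xy , only = reg x Ux in y , from (inj₁ Uy) , xy , λ z q xz →
        case ∋-comprehension⁻ extended? q of λ
          { (inj₁ Uz) → only z Uz xz
          ; (inj₂ (inj₁ refl)) → contradiction (x , Ux , inj₁ (edge-sym xz)) none
          ; (inj₂ (inj₂ refl)) → contradiction (x , Ux , inj₂ (edge-sym xz)) none }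
      ... | inj₂ (inj₁ refl) = b , from (inj₂ (inj₂ refl)) , ab , λ z q az →
        case ∋-comprehension⁻ extended? q of λ
          { (inj₁ Uz) → contradiction (z , Uz , inj₁ az) none
          ; (inj₂ (inj₁ refl)) → contradiction az edge-irrefl
          ; (inj₂ (inj₂ eq)) → eq }
      ... | inj₂ (inj₂ refl) = a , from (inj₂ (inj₁ refl)) , edge-sym ab , λ z q bz →
        case ∋-comprehension⁻ extended? q of λ
          { (inj₁ Uz) → contradiction (z , Uz , inj₂ bz) none
          ; (inj₂ (inj₁ eq)) → eq
          ; (inj₂ (inj₂ refl)) → contradiction bz edge-irrefl }
      M≡ : M ≡ inducedEdges U⁺
      M≡ = maximal (inducedEdges U⁺) (oneRegular⇒inducedMatching reg⁺) λ i j p →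
        let Ui , Uj , e = inducedEdges⁻ (⊆-inducedEdges induced i j p) in inducedEdges⁺ (from (inj₁ Ui)) (from (inj₁ Uj)) e
      ba∈M : (b , a) ∈E M
      ba∈M = subst ((b , a) ∈E_) (sym M≡) (inducedEdges⁺ (from (inj₂ (inj₂ refl))) (from (inj₂ (inj₁ refl))) (edge-sym ab))

  isMIM⇒maximal : ∀ {U} → IsMIM (everything G) U → IsMaximalInducedMatching G (inducedEdges U)
  isMIM⇒maximal {U} (mim _ reg max) = oneRegular⇒inducedMatching reg , λ M′ induced sub → ∈E-ext sub (reverse M′ induced sub)
    where
    module _ (M′ : EdgeSet n) (induced : IsInducedMatching G M′) (sub : inducedEdges U ⊆E M′) where
      edges = proj₁ induced
      symmetric = proj₁ (proj₂ induced)
      regular = proj₂ (proj₂ induced)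
      covered : ∀ {c} → U ∋ c → InV M′ c
      covered {c} Uc = let y , Uy , cy , _ = reg c Uc in y , sub c y (inducedEdges⁺ Uc Uy cy)
      -- Endpoints in U remain endpoints of M′, where i has j as its only neighbour; hence c = j.
      partner : ∀ {i j c} → (i , j) ∈E M′ → U ∋ c → Edge G i c → U ∋ j
      partner {i} {j} {c} p Uc ic = subst (U ∋_)
        (proj₂ (regular i (j , p)) c j (covered Uc) ic (InV-right {M′} induced p) (edges i j p)) Uc
      partner² : ∀ {i j} → (i , j) ∈E M′ → U ∋ j → U ∋ i
      partner² {i} {j} p Uj = let y , Uy , jy , _ = reg j Uj in partner (subst T (symmetric i j) p) Uy jy
      reverse : M′ ⊆E inducedEdges U
      reverse i j p with max i j (in-set tt) (in-set tt) (edges i j p)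
      ... | c , Uc , inj₁ ic = let Uj = partner p Uc ic in inducedEdges⁺ (partner² p Uj) Uj (edges i j p)
      ... | c , Uc , inj₂ jc = let p′ = subst T (symmetric i j) p; Ui = partner p′ Uc jc in
        inducedEdges⁺ Ui (partner² p′ Ui) (edges i j p)

  -- `endpoints` and `inducedEdges` are mutually inverse between the maximal induced matchings and
  -- their endpoint sets; each gives one of the two inequalities.
  count≡#MIM : ∀ {k} → NumMaxIndMatchings G k → k ≡ #MIM (everything G)
  count≡#MIM (xs , unique , complete , refl) = ℕ.≤-antisym
    (length-≤-by-relation (λ M U → U ≡ endpoints M) {ys = MIMs (everything G)} unique
      (λ p → _ , ∈-MIMs⁺ (maximal⇒isMIM (sound p)) , refl)
      λ p q eq eq′ → trans (inducedEdges-endpoints (proj₁ (sound p))) (trans (cong inducedEdges (trans (sym eq) eq′))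
        (sym (inducedEdges-endpoints (proj₁ (sound q))))))
    (length-≤-by-relation (λ U M → M ≡ inducedEdges U) {ys = xs} (MIMs-unique (everything G))
      (λ p → _ , Equivalence.from (complete _) (isMIM⇒maximal (∈-MIMs⁻ p)) , refl)
      λ p q eq eq′ → trans (endpoints-inducedEdges (IsMIM.oneRegular (∈-MIMs⁻ p))) (trans (cong endpoints (trans (sym eq) eq′))
        (sym (endpoints-inducedEdges (IsMIM.oneRegular (∈-MIMs⁻ q))))))
    where
    sound : ∀ {M} → M ∈ xs → IsMaximalInducedMatching G M
    sound {M} = Equivalence.to (complete M)

  card-everything : card (everything G) ≡ n
  card-everything = trans (ℕ.≤-antisym
    (length-≤-by-⊆ {ys = allFin n} (elems-unique (everything G)) (λ {x} _ → ∈-allFin x))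
    (length-≤-by-⊆ {ys = elems (everything G)} (Unique.allFin⁺ n) (λ _ → ∈-elems⁺ (in-set tt)))) (length-tabulate id)

-- Comparison of the recursive bound and clique orders with their closed forms

qAt : ℕ → ℕ → ℕ
qAt t 0 = 10 ^ t
qAt t 1 = 15 * 10 ^ (t ∸ 1)
qAt t 2 = 225 * 10 ^ (t ∸ 2)
qAt t 3 = 36 * 10 ^ (t ∸ 1)
qAt t _ = 6 * 10 ^ t

sizesAt : ℕ → ℕ → List ℕ
sizesAt t 0 = replicate t 5
sizesAt t 1 = 6 ∷ replicate (t ∸ 1) 5
sizesAt t 2 = 6 ∷ 6 ∷ replicate (t ∸ 2) 5
sizesAt t 3 = 4 ∷ 4 ∷ replicate (t ∸ 1) 5
sizesAt t _ = 4 ∷ replicate t 5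

-- With quotient and remainder as separate arguments, passing from n to n + 5 only raises the
-- quotient.
q≡qAt : ∀ n → q n ≡ qAt (n / 5) (n % 5)
q≡qAt n with n % 5
... | 0 = refl
... | 1 = refl
... | 2 = refl
... | 3 = refl
... | suc (suc (suc (suc _))) = refl

extremalSizes≡sizesAt : ∀ n → extremalSizes n ≡ sizesAt (n / 5) (n % 5)
extremalSizes≡sizesAt n with n % 5
... | 0 = refl
... | 1 = refl
... | 2 = refl
... | 3 = refl
... | suc (suc (suc (suc _))) = refl

-- Guarantees that `t ∸ 1` and, for remainder 2, `t ∸ 2` are not truncated, so that raising t really
-- adds a factor ten or a K_5.
Admissible : ℕ → ℕ → Set
Admissible t r = 1 ≤ t × (r ≡ 2 → 2 ≤ t)

admissible : ∀ m → Admissible ((8 + m) / 5) ((8 + m) % 5)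
-- Quotient 1 with remainder 2 would be order 7, below 8.
admissible m = 1≤t , λ r≡2 → ℕ.≤∧≢⇒< 1≤t λ 1≡t →
  contradiction (trans (m≡m%n+[m/n]*n (8 + m) 5) (cong₂ (λ r t → r + t * 5) r≡2 (sym 1≡t))) λ ()
  where
  1≤t : 1 ≤ (8 + m) / 5
  1≤t = m≥n⇒m/n>0 {8 + m} {5} (ℕ.m≤m+n 5 (3 + m))

qAt-suc : ∀ t r → Admissible t r → qAt (suc t) r ≡ 10 * qAt t r
qAt-suc t 0 _ = refl
qAt-suc (suc t) 1 _ = *-exchange 15 (10 ^ t)
qAt-suc t 2 (_ , 2≤) with t | 2≤ refl
... | suc (suc t) | _ = *-exchange 225 (10 ^ t)
... | suc zero | s≤s ()
qAt-suc (suc t) 3 _ = *-exchange 36 (10 ^ t)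
qAt-suc t (suc (suc (suc (suc _)))) _ = *-exchange 6 (10 ^ t)

sizesAt-suc : ∀ t r → Admissible t r → (5 ∷ sizesAt t r) ↭ sizesAt (suc t) r
sizesAt-suc t 0 _ = ↭-refl
sizesAt-suc (suc t) 1 _ = swap 5 6 ↭-refl
sizesAt-suc t 2 (_ , 2≤) with t | 2≤ refl
... | suc (suc t) | _ = ↭-trans (swap 5 6 ↭-refl) (prep 6 (swap 5 6 ↭-refl))
... | suc zero | s≤s ()
sizesAt-suc (suc t) 3 _ = ↭-trans (swap 5 4 ↭-refl) (prep 4 (swap 5 4 ↭-refl))
sizesAt-suc t (suc (suc (suc (suc _)))) _ = swap 5 4 ↭-refl

five-more : ∀ {A : Set} (h : ℕ → ℕ → A) m → h ((13 + m) / 5) ((13 + m) % 5) ≡ h (suc ((8 + m) / 5)) ((8 + m) % 5)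
five-more h m = cong₂ h (m/n≡1+[m∸n]/n {13 + m} {5} (ℕ.m≤m+n 5 (8 + m))) (sym (m≤n⇒[n∸m]%m≡n%m {5} {13 + m} (ℕ.m≤m+n 5 (8 + m))))

bound≡q : ∀ m → bound (8 + m) ≡ q (8 + m)
bound≡q = from-8 (λ n → bound n ≡ q n) refl refl refl refl refl λ m ih → begin
  10 * bound (8 + m)                               ≡⟨ cong (10 *_) ih ⟩
  10 * q (8 + m)                                   ≡⟨ cong (10 *_) (q≡qAt (8 + m)) ⟩
  10 * qAt ((8 + m) / 5) ((8 + m) % 5)             ≡⟨ qAt-suc ((8 + m) / 5) ((8 + m) % 5) (admissible m) ⟨
  qAt (suc ((8 + m) / 5)) ((8 + m) % 5)            ≡⟨ five-more qAt m ⟨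
  qAt ((13 + m) / 5) ((13 + m) % 5)                ≡⟨ q≡qAt (13 + m) ⟨
  q (13 + m)                                       ∎
  where open ≡-Reasoning

sizes↭extremalSizes : ∀ m → sizes (8 + m) ↭ extremalSizes (8 + m)
sizes↭extremalSizes = from-8 (λ n → sizes n ↭ extremalSizes n) ↭-refl ↭-refl ↭-refl ↭-refl ↭-refl λ m ih →
  subst (sizes (13 + m) ↭_) (sym (trans (extremalSizes≡sizesAt (13 + m)) (five-more sizesAt m)))
    (↭-trans (prep 5 (subst (sizes (8 + m) ↭_) (extremalSizes≡sizesAt (8 + m)) ih))
      (sizesAt-suc ((8 + m) / 5) ((8 + m) % 5) (admissible m)))

product-sizes : ∀ m → product (map choose₂ (sizes (8 + m))) ≡ bound (8 + m)
product-sizes = from-8 (λ n → product (map choose₂ (sizes n)) ≡ bound n) refl refl refl refl refl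
  λ m ih → cong (10 *_) ih

theorem3p1 : (n : ℕ) → 8 ≤ n → (G : Graph n) → (k : ℕ) →
    NumMaxIndMatchings G k →
    (k ≤ q n) × ((k ≡ q n) ⇔ (G ≅ extremal n))
theorem3p1 n 8≤n G k num with ℕ.m≤n⇒∃[o]m+o≡n 8≤n
... | m , refl = subst₂ _≤_ (sym k≡) bound-everything≡ (proj₁ (optimal G all)) , mk⇔ unique attained
  where
  open Matchings G
  all = everything G
  k≡ : k ≡ #MIM all
  k≡ = count≡#MIM G num
  bound-everything≡ : bound (card all) ≡ q (8 + m)
  bound-everything≡ = trans (cong bound (card-everything G)) (bound≡q m)
  unique : k ≡ q (8 + m) → G ≅ extremal (8 + m)
  unique eq = layout⇒≅ G (extremalSizes (8 + m)) (partition⇒layout G (partition-↭ G (sizes↭extremalSizes m)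
    (subst (λ c → CliquePartition G all (sizes c)) (card-everything G)
      (proj₂ (optimal G all) (trans (sym k≡) (trans eq (sym bound-everything≡)))
        (inj₂ (subst (4 ≤_) (sym (card-everything G)) (ℕ.m≤m+n 4 (4 + m))))))))
  attained : G ≅ extremal (8 + m) → k ≡ q (8 + m)
  attained iso = ℕ.≤-antisym (subst₂ _≤_ (sym k≡) bound-everything≡ (proj₁ (optimal G all)))
    -- A union of cliques has at least the product of their edge numbers as its count, and for the
    -- extremal orders this product is the bound.
    (subst₂ _≤_ (trans (product-sizes m) (bound≡q m)) (sym k≡)
      (#MIM-partition-≥ G (partition-↭ G (↭-sym (sizes↭extremalSizes m))
        (layout⇒partition G (extremalSizes (8 + m)) (≅⇒layout G (extremalSizes (8 + m)) iso)))))
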